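{- For all sufficiently large $n$, $$\tfrac12 \log_2 n \le h_3(n,\{(4,1),(4,3)\}) < 4(\log_2 n)^2.$$
   Context: For an $r$-uniform hypergraph ($r$-graph) $H$, a homogeneous set is a set of vertices that is either a clique (every $r$-subset is an edge) or a coclique (no $r$-subset is an edge); $h(H)$ denotes the size of a largest homogeneous set. An $(m,f)$-graph is an $r$-graph with $m$ vertices and $f$ edges; $H$ is $(m,f)$-free if it contains no induced sub-hypergraph that is an $(m,f)$-graph. For a set $Q$ of pairs $(m,f)$, $H$ is $Q$-free if it is $(m,f)$-free for every $(m,f)\in Q$. $h_r(n,Q)$ is the minimum of $h(H)$ over all $n$-vertex $Q$-free $r$-graphs $H$. -}

module Defs where

open import Data.Bool using (Bool; T; T?)
open import Data.Fin.Subset using (Subset; ∣_∣; _⊆_; inside; outside)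
open import Data.Fin.Subset.Properties using (_⊆?_)
open import Data.Integer as ℤ using (+_)
import Data.Integer.Properties as ℤₚ
open import Data.List using (List; []; _∷_; _++_; map; filter; length)
import Data.Vec as Vec
open import Data.Nat as ℕ using (ℕ; zero; suc; NonZero)
open import Data.Nat.Induction using (<-rec)
open import Data.Nat.Logarithm using (⌊log₂_⌋; ⌊log₂⌊n/2⌋⌋≡⌊log₂n⌋∸1; ⌊log₂[2^n]⌋≡n; ⌊log₂⌋-mono-≤)
import Data.Nat.Properties as ℕₚ
open import Data.Product using (Σ; ∃-syntax; _×_; _,_; proj₁; proj₂)
open import Data.Rational as ℚ using (ℚ; 0ℚ; 1ℚ; mkℚ)
import Data.Rational.Properties as ℚₚ
open import Data.Rational.Unnormalised as ℚᵘ using (mkℚᵘ)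
import Data.Rational.Unnormalised.Properties as ℚᵘₚ
open import Data.Rational.Solver using (module +-*-Solver)
open import Data.Sum using (_⊎_; inj₁; inj₂)
open import Level using (0ℓ)
open import Relation.Binary.PropositionalEquality
open import Relation.Nullary using (¬_)
open import Relation.Nullary.Decidable using (_×-dec_)
open import Relation.Unary using (Pred)

------------------------------------------------------------------------
-- Extremal elements of sets of natural numbers

IsMin : Pred ℕ 0ℓ → ℕ → Set
IsMin P k = P k × (∀ j → P j → k ℕ.≤ j)

IsMax : Pred ℕ 0ℓ → ℕ → Set
IsMax P k = P k × (∀ j → P j → j ℕ.≤ k)

IsMin-unique : ∀ {P k l} → IsMin P k → IsMin P l → k ≡ l
IsMin-unique (pk , k≤) (pl , l≤) = ℕₚ.≤-antisym (k≤ _ pl) (l≤ _ pk)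

IsMax-unique : ∀ {P k l} → IsMax P k → IsMax P l → k ≡ l
IsMax-unique (pk , ≤k) (pl , ≤l) = ℕₚ.≤-antisym (≤l _ pk) (≤k _ pl)

------------------------------------------------------------------------
-- r-uniform hypergraphs

-- Vertex set Fin n; isEdge is the characteristic function of the edge set.
record RGraph (r n : ℕ) : Set where
  field
    isEdge  : Subset n → Bool
    uniform : ∀ e → T (isEdge e) → ∣ e ∣ ≡ r

open RGraph public

module _ {r n : ℕ} (H : RGraph r n) where

  -- Sets with fewer than r vertices are both cliques and cocliques.
  IsClique : Subset n → Set
  IsClique S = ∀ e → e ⊆ S → ∣ e ∣ ≡ r → T (isEdge H e)

  IsCoclique : Subset n → Set
  IsCoclique S = ∀ e → e ⊆ S → ∣ e ∣ ≡ r → ¬ T (isEdge H e)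

  IsHomogeneous : Subset n → Set
  IsHomogeneous S = IsClique S ⊎ IsCoclique S

  -- Is-h k  means  h(H) = k.
  Is-h : ℕ → Set
  Is-h = IsMax (λ k → ∃[ S ] (IsHomogeneous S × ∣ S ∣ ≡ k))

-- Every subset of Fin n, listed exactly once.
subsets : ∀ n → List (Subset n)
subsets zero    = Vec.[] ∷ []
subsets (suc n) = map (outside Vec.∷_) (subsets n) ++ map (inside Vec.∷_) (subsets n)

module _ {r n : ℕ} (H : RGraph r n) where

  -- The edge set of the sub-hypergraph H[W] induced on the vertex set W.
  inducedEdges : Subset n → List (Subset n)
  inducedEdges W = filter (λ e → (e ⊆? W) ×-dec T? (isEdge H e)) (subsets n)

  -- H[W] is an (m , f)-graph.
  InducesGraph : ℕ × ℕ → Subset n → Set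
  InducesGraph (m , f) W = ∣ W ∣ ≡ m × length (inducedEdges W) ≡ f

  IsFree : Pred (ℕ × ℕ) 0ℓ → Set
  IsFree Q = ∀ mf → Q mf → ¬ (∃[ W ] InducesGraph mf W)

-- Is-hᵣ r n Q k  means  h_r(n,Q) = k; such a k is unique by IsMin-unique.
Is-hᵣ : (r n : ℕ) → Pred (ℕ × ℕ) 0ℓ → ℕ → Set
Is-hᵣ r n Q = IsMin (λ k → Σ (RGraph r n) (λ H → IsFree H Q × Is-h H k))

------------------------------------------------------------------------
-- Real numbers as Cauchy sequences of rationals

record ℝ : Set where
  field
    seq    : ℕ → ℚ
    cauchy : ∀ ε → 0ℚ ℚ.< ε →
             ∃[ N ] (∀ i j → N ℕ.≤ i → N ℕ.≤ j → ℚ.∣ seq i ℚ.- seq j ∣ ℚ.≤ ε)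

open ℝ public

-- x <ᴿ y holds when some positive rational eventually separates the sequences;
-- x ≤ᴿ y is equivalent to ¬ (y <ᴿ x).
infix 4 _≤ᴿ_ _<ᴿ_

_≤ᴿ_ : ℝ → ℝ → Set
x ≤ᴿ y = ∀ ε → 0ℚ ℚ.< ε → ∃[ N ] (∀ k → N ℕ.≤ k → seq x k ℚ.≤ seq y k ℚ.+ ε)

_<ᴿ_ : ℝ → ℝ → Set
x <ᴿ y = ∃[ ε ] (0ℚ ℚ.< ε × ∃[ N ] (∀ k → N ℕ.≤ k → seq x k ℚ.+ ε ℚ.≤ seq y k))

fromℚ : ℚ → ℝ
fromℚ q .seq _ = q
fromℚ q .cauchy ε ε>0 =
  0 , λ _ _ _ _ → ℚₚ.≤-trans (ℚₚ.≤-reflexive (cong ℚ.∣_∣ (ℚₚ.+-inverseʳ q))) (ℚₚ.<⇒≤ ε>0)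

fromℕ : ℕ → ℝ
fromℕ n = fromℚ (+ n ℚ./ 1)

private
  0<1 : 0ℚ ℚ.< 1ℚ
  0<1 = ℚₚ.positive⁻¹ 1ℚ

  IsBound : (ℕ → ℚ) → ℚ → ℕ → Set
  IsBound s B N = ∀ i → N ℕ.≤ i → ℚ.∣ s i ∣ ℚ.≤ B

  bounded : (x : ℝ) → ∃[ B ] (0ℚ ℚ.< B × ∃[ N ] IsBound (seq x) B N)
  bounded x with cauchy x 1ℚ 0<1
  ... | N , close = B , B>0 , N , bound
    where
    open ℚₚ.≤-Reasoning
    B : ℚ
    B = 1ℚ ℚ.+ ℚ.∣ seq x N ∣
    B>0 : 0ℚ ℚ.< B
    B>0 = ℚₚ.+-mono-<-≤ 0<1 (ℚₚ.0≤∣p∣ (seq x N))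
    split : ∀ a b → a ≡ (a ℚ.- b) ℚ.+ b
    split = solve 2 (λ a b → a := (a :- b) :+ b) refl
      where open +-*-Solver
    bound : ∀ i → N ℕ.≤ i → ℚ.∣ seq x i ∣ ℚ.≤ B
    bound i N≤i = begin
      ℚ.∣ seq x i ∣                                 ≡⟨ cong ℚ.∣_∣ (split (seq x i) (seq x N)) ⟩
      ℚ.∣ (seq x i ℚ.- seq x N) ℚ.+ seq x N ∣        ≤⟨ ℚₚ.∣p+q∣≤∣p∣+∣q∣ (seq x i ℚ.- seq x N) (seq x N) ⟩
      ℚ.∣ seq x i ℚ.- seq x N ∣ ℚ.+ ℚ.∣ seq x N ∣    ≤⟨ ℚₚ.+-monoˡ-≤ ℚ.∣ seq x N ∣ (close i N N≤i ℕₚ.≤-refl) ⟩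
      B                                             ∎

  *-mono-≤-abs : ∀ {a b c d} → ℚ.∣ a ∣ ℚ.≤ c → ℚ.∣ b ∣ ℚ.≤ d → ℚ.∣ a ℚ.* b ∣ ℚ.≤ c ℚ.* d
  *-mono-≤-abs {a} {b} {c} {d} a≤c b≤d = begin
    ℚ.∣ a ℚ.* b ∣          ≡⟨ ℚₚ.∣p*q∣≡∣p∣*∣q∣ a b ⟩
    ℚ.∣ a ∣ ℚ.* ℚ.∣ b ∣    ≤⟨ ℚₚ.*-monoˡ-≤-nonNeg ℚ.∣ a ∣ {{ℚₚ.∣-∣-nonNeg a}} b≤d ⟩
    ℚ.∣ a ∣ ℚ.* d          ≤⟨ ℚₚ.*-monoʳ-≤-nonNeg d {{ℚ.nonNegative (ℚₚ.≤-trans (ℚₚ.0≤∣p∣ b) b≤d)}} a≤c ⟩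
    c ℚ.* d                ∎
    where open ℚₚ.≤-Reasoning

  *-difference : ∀ a b c d → a ℚ.* b ℚ.- c ℚ.* d ≡ a ℚ.* (b ℚ.- d) ℚ.+ (a ℚ.- c) ℚ.* d
  *-difference = solve 4 (λ a b c d → a :* b :- c :* d := a :* (b :- d) :+ (a :- c) :* d) refl
    where open +-*-Solver
  *-collect : ∀ a b c → a ℚ.* c ℚ.+ c ℚ.* b ≡ c ℚ.* (a ℚ.+ b)
  *-collect = solve 3 (λ a b c → a :* c :+ c :* b := c :* (a :+ b)) refl
    where open +-*-Solver

  *-cauchy : ∀ x y {Bx By Nx Ny} → 0ℚ ℚ.< Bx → 0ℚ ℚ.< By →
             IsBound (seq x) Bx Nx → IsBound (seq y) By Ny → ∀ ε → 0ℚ ℚ.< ε →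
             ∃[ N ] (∀ i j → N ℕ.≤ i → N ℕ.≤ j →
               ℚ.∣ seq x i ℚ.* seq y i ℚ.- seq x j ℚ.* seq y j ∣ ℚ.≤ ε)
  *-cauchy x y {Bx} {By} {Nx} {Ny} Bx>0 By>0 xb yb ε ε>0 = N , close
    where
    B : ℚ
    B = Bx ℚ.+ By
    instance
      Bpos : ℚ.Positive B
      Bpos = ℚ.positive (ℚₚ.+-mono-< Bx>0 By>0)
      Bnz : ℚ.NonZero B
      Bnz = ℚₚ.pos⇒nonZero B
    δ : ℚ
    δ = ε ℚ.* (ℚ.1/ B)
    δ>0 : 0ℚ ℚ.< δ
    δ>0 = ℚₚ.positive⁻¹ δ {{ℚₚ.pos*pos⇒pos ε {{ℚ.positive ε>0}} (ℚ.1/ B) {{ℚₚ.1/pos⇒pos B}}}}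
    cx = cauchy x δ δ>0
    cy = cauchy y δ δ>0
    N : ℕ
    N = (Nx ℕ.+ Ny) ℕ.+ (proj₁ cx ℕ.+ proj₁ cy)
    close : ∀ i j → N ℕ.≤ i → N ℕ.≤ j →
            ℚ.∣ seq x i ℚ.* seq y i ℚ.- seq x j ℚ.* seq y j ∣ ℚ.≤ ε
    close i j N≤i N≤j = begin
      ℚ.∣ xi ℚ.* yi ℚ.- xj ℚ.* yj ∣
        ≡⟨ cong ℚ.∣_∣ (*-difference xi yi xj yj) ⟩
      ℚ.∣ xi ℚ.* (yi ℚ.- yj) ℚ.+ (xi ℚ.- xj) ℚ.* yj ∣
        ≤⟨ ℚₚ.∣p+q∣≤∣p∣+∣q∣ (xi ℚ.* (yi ℚ.- yj)) ((xi ℚ.- xj) ℚ.* yj) ⟩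
      ℚ.∣ xi ℚ.* (yi ℚ.- yj) ∣ ℚ.+ ℚ.∣ (xi ℚ.- xj) ℚ.* yj ∣
        ≤⟨ ℚₚ.+-mono-≤ (*-mono-≤-abs (xb i (ℕₚ.≤-trans Nx≤ N≤i)) (proj₂ cy i j (ℕₚ.≤-trans cy≤ N≤i) (ℕₚ.≤-trans cy≤ N≤j)))
                       (*-mono-≤-abs (proj₂ cx i j (ℕₚ.≤-trans cx≤ N≤i) (ℕₚ.≤-trans cx≤ N≤j)) (yb j (ℕₚ.≤-trans Ny≤ N≤j))) ⟩
      Bx ℚ.* δ ℚ.+ δ ℚ.* By  ≡⟨ *-collect Bx By δ ⟩
      δ ℚ.* B                ≡⟨ ℚₚ.*-assoc ε (ℚ.1/ B) B ⟩
      ε ℚ.* (ℚ.1/ B ℚ.* B)   ≡⟨ cong (ε ℚ.*_) (ℚₚ.*-inverseˡ B) ⟩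
      ε ℚ.* 1ℚ               ≡⟨ ℚₚ.*-identityʳ ε ⟩
      ε                      ∎
      where
      open ℚₚ.≤-Reasoning
      xi = seq x i
      xj = seq x j
      yi = seq y i
      yj = seq y j
      Nx≤ : Nx ℕ.≤ N
      Nx≤ = ℕₚ.≤-trans (ℕₚ.m≤m+n Nx Ny) (ℕₚ.m≤m+n _ _)
      Ny≤ : Ny ℕ.≤ N
      Ny≤ = ℕₚ.≤-trans (ℕₚ.m≤n+m Ny Nx) (ℕₚ.m≤m+n _ _)
      cx≤ : proj₁ cx ℕ.≤ N
      cx≤ = ℕₚ.≤-trans (ℕₚ.m≤m+n (proj₁ cx) (proj₁ cy)) (ℕₚ.m≤n+m _ (Nx ℕ.+ Ny))
      cy≤ : proj₁ cy ℕ.≤ N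
      cy≤ = ℕₚ.≤-trans (ℕₚ.m≤n+m (proj₁ cy) (proj₁ cx)) (ℕₚ.m≤n+m _ (Nx ℕ.+ Ny))

infixl 7 _*ᴿ_

_*ᴿ_ : ℝ → ℝ → ℝ
(x *ᴿ y) .seq k = seq x k ℚ.* seq y k
(x *ᴿ y) .cauchy =
  let _ , Bx>0 , _ , xb = bounded x
      _ , By>0 , _ , yb = bounded y
  in *-cauchy x y Bx>0 By>0 xb yb

------------------------------------------------------------------------
-- Real base-2 logarithm

⌊log₂⌋-lower : ∀ n .{{_ : NonZero n}} → 2 ℕ.^ ⌊log₂ n ⌋ ℕ.≤ n
⌊log₂⌋-lower = <-rec (λ n → .{{_ : NonZero n}} → 2 ℕ.^ ⌊log₂ n ⌋ ℕ.≤ n) step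
  where
  open ℕₚ.≤-Reasoning
  step : ∀ n → (∀ {m} → m ℕ.< n → .{{_ : NonZero m}} → 2 ℕ.^ ⌊log₂ m ⌋ ℕ.≤ m) →
         .{{_ : NonZero n}} → 2 ℕ.^ ⌊log₂ n ⌋ ℕ.≤ n
  step 1 _ = ℕₚ.≤-refl
  step n@(suc (suc n-2)) ih = begin
    2 ℕ.^ ⌊log₂ n ⌋                      ≤⟨ ℕₚ.^-monoʳ-≤ 2 log≤ ⟩
    2 ℕ.* 2 ℕ.^ ⌊log₂ half ⌋             ≤⟨ ℕₚ.*-monoʳ-≤ 2 (ih (ℕₚ.⌊n/2⌋<n (suc n-2))) ⟩
    2 ℕ.* half                           ≡⟨ cong (half ℕ.+_) (ℕₚ.+-identityʳ half) ⟩
    half ℕ.+ half                        ≤⟨ ℕₚ.+-monoʳ-≤ half (ℕₚ.⌊n/2⌋≤⌈n/2⌉ n) ⟩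
    half ℕ.+ ℕ.⌈ n /2⌉                   ≡⟨ ℕₚ.⌊n/2⌋+⌈n/2⌉≡n n ⟩
    n                                    ∎
    where
    half = ℕ.⌊ n /2⌋
    log≤ : ⌊log₂ n ⌋ ℕ.≤ suc ⌊log₂ half ⌋
    log≤ = subst (λ z → ⌊log₂ n ⌋ ℕ.≤ suc z) (sym (⌊log₂⌊n/2⌋⌋≡⌊log₂n⌋∸1 n)) (ℕₚ.m≤n+m∸n _ 1)

⌊log₂⌋-upper : ∀ n → n ℕ.< 2 ℕ.^ suc ⌊log₂ n ⌋
⌊log₂⌋-upper n = ℕₚ.≰⇒> λ 2^≤n →
  ℕₚ.<-irrefl refl (subst (ℕ._≤ ⌊log₂ n ⌋) (⌊log₂[2^n]⌋≡n (suc ⌊log₂ n ⌋)) (⌊log₂⌋-mono-≤ 2^≤n))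

private
  ^-reflects-≤ : ∀ {a b} → 2 ℕ.^ a ℕ.≤ 2 ℕ.^ b → a ℕ.≤ b
  ^-reflects-≤ {a} {b} le = ℕₚ.≮⇒≥ λ b<a →
    ℕₚ.<-irrefl refl (ℕₚ.<-≤-trans (ℕₚ.^-monoʳ-< 2 (ℕ.s≤s (ℕ.s≤s ℕ.z≤n)) b<a) le)

  log-cross : ∀ n .{{_ : NonZero n}} a b →
              ⌊log₂ n ℕ.^ a ⌋ ℕ.* b ℕ.≤ suc ⌊log₂ n ℕ.^ b ⌋ ℕ.* a
  log-cross n a b = ^-reflects-≤ (begin
    2 ℕ.^ (p ℕ.* b)          ≡⟨ sym (ℕₚ.^-*-assoc 2 p b) ⟩
    (2 ℕ.^ p) ℕ.^ b          ≤⟨ ℕₚ.^-monoˡ-≤ b (⌊log₂⌋-lower (n ℕ.^ a) {{ℕₚ.m^n≢0 n a}}) ⟩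
    (n ℕ.^ a) ℕ.^ b          ≡⟨ ℕₚ.^-*-assoc n a b ⟩
    n ℕ.^ (a ℕ.* b)          ≡⟨ cong (n ℕ.^_) (ℕₚ.*-comm a b) ⟩
    n ℕ.^ (b ℕ.* a)          ≡⟨ sym (ℕₚ.^-*-assoc n b a) ⟩
    (n ℕ.^ b) ℕ.^ a          ≤⟨ ℕₚ.^-monoˡ-≤ a (ℕₚ.<⇒≤ (⌊log₂⌋-upper (n ℕ.^ b))) ⟩
    (2 ℕ.^ suc q) ℕ.^ a      ≡⟨ ℕₚ.^-*-assoc 2 (suc q) a ⟩
    2 ℕ.^ (suc q ℕ.* a)      ∎)
    where
    open ℕₚ.≤-Reasoning
    p = ⌊log₂ n ℕ.^ a ⌋
    q = ⌊log₂ n ℕ.^ b ⌋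

  fraction-≤ : ∀ p q a b → p ℕ.* suc b ℕ.≤ q ℕ.* suc a → (+ p ℚ./ suc a) ℚ.≤ (+ q ℚ./ suc b)
  fraction-≤ p q a b le = ℚₚ.toℚᵘ-cancel-≤ (begin
    ℚ.toℚᵘ (+ p ℚ./ suc a)  ≃⟨ ℚₚ.toℚᵘ-fromℚᵘ (mkℚᵘ (+ p) a) ⟩
    mkℚᵘ (+ p) a            ≤⟨ ℚᵘ.*≤* (subst₂ ℤ._≤_ (ℤₚ.pos-* p (suc b)) (ℤₚ.pos-* q (suc a)) (ℤ.+≤+ le)) ⟩
    mkℚᵘ (+ q) b            ≃⟨ ℚᵘₚ.≃-sym (ℚₚ.toℚᵘ-fromℚᵘ (mkℚᵘ (+ q) b)) ⟩
    ℚ.toℚᵘ (+ q ℚ./ suc b)  ∎)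
    where open ℚᵘₚ.≤-Reasoning

  fraction-suc : ∀ q b → + suc q ℚ./ suc b ≡ (+ 1 ℚ./ suc b) ℚ.+ (+ q ℚ./ suc b)
  fraction-suc q b = ℚₚ.toℚᵘ-injective (begin
    ℚ.toℚᵘ (+ suc q ℚ./ suc b)                          ≈⟨ ℚₚ.toℚᵘ-fromℚᵘ (mkℚᵘ (+ suc q) b) ⟩
    mkℚᵘ (+ suc q) b                                    ≈⟨ ℚᵘ.*≡* eq ⟩
    mkℚᵘ (+ 1) b ℚᵘ.+ mkℚᵘ (+ q) b                      ≈⟨ ℚᵘₚ.+-cong (ℚᵘₚ.≃-sym (ℚₚ.toℚᵘ-fromℚᵘ (mkℚᵘ (+ 1) b))) (ℚᵘₚ.≃-sym (ℚₚ.toℚᵘ-fromℚᵘ (mkℚᵘ (+ q) b))) ⟩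
    ℚ.toℚᵘ (+ 1 ℚ./ suc b) ℚᵘ.+ ℚ.toℚᵘ (+ q ℚ./ suc b)  ≈⟨ ℚᵘₚ.≃-sym (ℚₚ.toℚᵘ-homo-+ (+ 1 ℚ./ suc b) (+ q ℚ./ suc b)) ⟩
    ℚ.toℚᵘ ((+ 1 ℚ./ suc b) ℚ.+ (+ q ℚ./ suc b))        ∎)
    where
    open ℚᵘₚ.≃-Reasoning
    d = + suc b
    eq : + suc q ℤ.* (d ℤ.* d) ≡ (+ 1 ℤ.* d ℤ.+ + q ℤ.* d) ℤ.* d
    eq = trans (sym (ℤₚ.*-assoc (+ suc q) d d)) (cong (ℤ._* d) (ℤₚ.*-distribʳ-+ d (+ 1) (+ q)))

  archimedean : ∀ ε → 0ℚ ℚ.< ε → ∃[ N ] (∀ k → N ℕ.≤ k → (+ 1 ℚ./ suc k) ℚ.≤ ε)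
  archimedean ε ε>0 = go ε (ℚ.positive ε>0)
    where
    go : ∀ ε → ℚ.Positive ε → ∃[ N ] (∀ k → N ℕ.≤ k → (+ 1 ℚ./ suc k) ℚ.≤ ε)
    go ε@(mkℚ ℤ.+[1+ m ] d _) _ = d , λ k d≤k →
      subst ((+ 1 ℚ./ suc k) ℚ.≤_) (ℚₚ.↥p/↧p≡p ε)
        (fraction-≤ 1 (suc m) k d (ℕₚ.*-mono-≤ (ℕ.s≤s (ℕ.z≤n {m})) (ℕ.s≤s d≤k)))

  abs-≤ : ∀ {x y ε} → x ℚ.≤ ε ℚ.+ y → y ℚ.≤ ε ℚ.+ x → ℚ.∣ x ℚ.- y ∣ ℚ.≤ ε
  abs-≤ {x} {y} {ε} x≤ y≤ with ℚₚ.∣p∣≡p∨∣p∣≡-p (x ℚ.- y)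
  ... | inj₁ eq = subst₂ ℚ._≤_ (sym eq) (cancel ε y) (ℚₚ.+-monoˡ-≤ (ℚ.- y) x≤)
    where
    cancel : ∀ a b → a ℚ.+ b ℚ.- b ≡ a
    cancel = solve 2 (λ a b → a :+ b :- b := a) refl where open +-*-Solver
  ... | inj₂ eq = subst₂ ℚ._≤_ (trans (flip y x) (sym eq)) (cancel ε x) (ℚₚ.+-monoˡ-≤ (ℚ.- x) y≤)
    where
    flip : ∀ a b → a ℚ.- b ≡ ℚ.- (b ℚ.- a)
    flip = solve 2 (λ a b → a :- b := :- (b :- a)) refl where open +-*-Solver
    cancel : ∀ a b → a ℚ.+ b ℚ.- b ≡ a
    cancel = solve 2 (λ a b → a :+ b :- b := a) refl where open +-*-Solver

-- By ⌊log₂⌋-lower and ⌊log₂⌋-upper, p = ⌊log₂ n ^ k ⌋ satisfies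
-- 2 ^ p ≤ n ^ k < 2 ^ (p + 1), so the real logarithm of n lies in
-- [ p / k , (p + 1) / k ); log₂ n is the limit of p / k as k → ∞.
log₂ : (n : ℕ) .{{_ : NonZero n}} → ℝ
log₂ n .seq k = + ⌊log₂ n ℕ.^ suc k ⌋ ℚ./ suc k
log₂ n .cauchy ε ε>0 =
  proj₁ arch , λ i j N≤i N≤j → abs-≤ (half i j N≤j) (half j i N≤i)
  where
  arch = archimedean ε ε>0
  L : ℕ → ℕ
  L k = ⌊log₂ n ℕ.^ suc k ⌋
  half : ∀ i j → proj₁ arch ℕ.≤ j → (+ L i ℚ./ suc i) ℚ.≤ ε ℚ.+ (+ L j ℚ./ suc j)
  half i j N≤j = begin
    + L i ℚ./ suc i                          ≤⟨ fraction-≤ (L i) (suc (L j)) i j (log-cross n (suc i) (suc j)) ⟩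
    + suc (L j) ℚ./ suc j                    ≡⟨ fraction-suc (L j) j ⟩
    (+ 1 ℚ./ suc j) ℚ.+ (+ L j ℚ./ suc j)    ≤⟨ ℚₚ.+-monoˡ-≤ (+ L j ℚ./ suc j) (proj₂ arch j N≤j) ⟩
    ε ℚ.+ (+ L j ℚ./ suc j)                  ∎
    where open ℚₚ.≤-Reasoning

{-# OPTIONS --safe #-}
module Submission where

-- A 3-graph in which every four vertices span an even number of edges is a two-graph. If its link
-- at a vertex v is monochromatic on S, with colour b, then all triples of S ∪ {v} have colour b;
-- so the graph Ramsey bound R(a, b) ≤ 2 ^ (a + b), applied to the link, gives n ≤ 2 ^ (2 h).
-- Conversely the triples spanning an odd number of edges of a graph G form a two-graph, and a
-- homogeneous set S of it splits, for any v ∈ S, into v, the neighbours of v in S and the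
-- non-neighbours, the last two being homogeneous in G. A random G has no homogeneous set of
-- size k = 2 ⌊log₂ n⌋ + 6, so that h < 2 k ≤ 4 ⌊log₂ n⌋ ².

open import Defs
open import Data.Bool using (Bool; true; false; T; T?; _∧_; _xor_; not; if_then_else_)
open import Data.Bool.Properties using (T-∧; T-≡; ¬-not; xor-identityʳ)
open import Data.Fin using (zero; suc)
open import Data.Fin.Subset hiding (_∪_)
open import Data.Fin.Subset.Properties
open import Data.Integer as ℤ using ()
import Data.Integer.Properties as ℤ
open import Data.List as List using (List; []; _∷_; filter; length)
open import Data.List.Membership.Propositional using () renaming (_∈_ to _∈ₗ_)
open import Data.List.Membership.Propositional.Properties using (∈-map⁺; ∈-++⁺ˡ; ∈-++⁺ʳ)
import Data.List.Properties as List
open import Data.List.Relation.Unary.All as All using (All; []; _∷_)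
import Data.List.Relation.Unary.All.Properties as All
open import Data.List.Relation.Unary.Any using (here)
open import Data.Maybe using (Maybe; just; nothing)
open import Data.Nat
open import Data.Nat.ListAction using (sum)
open import Data.Nat.ListAction.Properties using (sum-++)
open import Data.Nat.Logarithm using (⌊log₂_⌋; ⌊log₂[2^n]⌋≡n; ⌊log₂⌋-mono-≤)
open import Data.Nat.Properties
open import Data.Nat.Tactic.RingSolver using (solve-∀)
open import Data.Product using (∃; ∃-syntax; _×_; _,_; proj₁; proj₂)
open import Data.Rational as ℚ using (ℚ; ½; 0ℚ; 1ℚ)
import Data.Rational.Properties as ℚ
open import Data.Rational.Unnormalised as ℚᵘ using (mkℚᵘ)
import Data.Rational.Unnormalised.Properties as ℚᵘ
open import Data.Sum as Sum using (_⊎_; inj₁; inj₂)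
open import Data.Unit using (tt) renaming (⊤ to Unit)
open import Data.Vec as Vec using (Vec; []; _∷_; here; there; lookup; replicate; tabulate; take; drop; _++_)
open import Data.Vec.Properties using ([]=⇒lookup; lookup⇒[]=; lookup∘tabulate; take++drop≡id)
open import Data.Vec.Relation.Binary.Pointwise.Inductive as Pointwise using (Pointwise; []; _∷_)
open import Function using (_∘_; Equivalence)
open import Level using (0ℓ)
open import Relation.Binary.PropositionalEquality
open import Relation.Nullary using (¬_; Dec; yes; no; does; contradiction)
open import Relation.Nullary.Decidable
  using (_×-dec_; _⊎-dec_; _→-dec_; ¬?; map′; dec-true; dec-false; decidable-stable; toWitnessFalse)
open import Relation.Unary using (Pred; Decidable; _≐_; ｛_｝; _∪_)

-- Counting subsets

countSubsets : ∀ {n} {P : Pred (Subset n) 0ℓ} → Decidable P → ℕ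
countSubsets {n} P? = length (filter P? (subsets n))

length-filter-map : ∀ {A B : Set} {P : Pred B 0ℓ} (P? : Decidable P) (f : A → B) xs →
                    length (filter P? (List.map f xs)) ≡ length (filter (P? ∘ f) xs)
length-filter-map P? f []       = refl
length-filter-map P? f (x ∷ xs) with P? (f x)
... | yes _ = cong suc (length-filter-map P? f xs)
... | no  _ = length-filter-map P? f xs

countSubsets-suc : ∀ {n} {P : Pred (Subset (suc n)) 0ℓ} (P? : Decidable P) →
                   countSubsets P? ≡ countSubsets (P? ∘ (outside ∷_)) + countSubsets (P? ∘ (inside ∷_))
countSubsets-suc {n} P? = begin
  length (filter P? (outs List.++ ins))                ≡⟨ cong length (List.filter-++ P? outs ins) ⟩
  length (filter P? outs List.++ filter P? ins)        ≡⟨ List.length-++ (filter P? outs) ⟩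
  length (filter P? outs) + length (filter P? ins)
    ≡⟨ cong₂ _+_ (length-filter-map P? _ (subsets n)) (length-filter-map P? _ (subsets n)) ⟩
  countSubsets (P? ∘ (outside ∷_)) + countSubsets (P? ∘ (inside ∷_)) ∎
  where
  open ≡-Reasoning
  outs = List.map (outside ∷_) (subsets n)
  ins  = List.map (inside ∷_) (subsets n)

countSubsets-≐ : ∀ {n} {P Q : Pred (Subset n) 0ℓ} (P? : Decidable P) (Q? : Decidable Q) →
                 P ≐ Q → countSubsets P? ≡ countSubsets Q?
countSubsets-≐ {n} P? Q? P≐Q = cong length (List.filter-≐ P? Q? P≐Q (subsets n))

countSubsets-none : ∀ {n} {P : Pred (Subset n) 0ℓ} (P? : Decidable P) → (∀ e → ¬ P e) → countSubsets P? ≡ 0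
countSubsets-none {n} P? ¬P = cong length (List.filter-none P? (All.universal ¬P (subsets n)))

countSubsets-≗ : ∀ {n} (f g : Subset n → Bool) → f ≗ g → countSubsets (T? ∘ f) ≡ countSubsets (T? ∘ g)
countSubsets-≗ f g f≗g = countSubsets-≐ (T? ∘ f) (T? ∘ g) (subst T (f≗g _) , subst T (sym (f≗g _)))

-- For `f = isEdge H` this is by definition the length of `inducedEdges H W`. Arbitrary `f` are
-- allowed so that recursion over the vertices can pass to `f ∘ (inside ∷_)`.
countInside : ∀ {n} → Subset n → (Subset n → Bool) → ℕ
countInside W f = countSubsets (λ e → (e ⊆? W) ×-dec T? (f e))

countInside-outside : ∀ {n} (W : Subset n) f → countInside (outside ∷ W) f ≡ countInside W (f ∘ (outside ∷_))
countInside-outside W f = begin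
  countInside (outside ∷ W) f                          ≡⟨ countSubsets-suc (λ e → (e ⊆? (outside ∷ W)) ×-dec T? (f e)) ⟩
  countSubsets (λ e → ((outside ∷ e) ⊆? (outside ∷ W)) ×-dec T? (f (outside ∷ e))) + _
    ≡⟨ cong₂ _+_ (countSubsets-≐ _ (λ e → (e ⊆? W) ×-dec T? (f (outside ∷ e)))
                    ( (λ (e⊆W , fe) → (λ {x} → drop-∷-⊆ e⊆W {x}) , fe)
                    , (λ (e⊆W , fe) → (λ {x} → out⊆ e⊆W {x}) , fe)))
                 (countSubsets-none (λ e → ((inside ∷ e) ⊆? (outside ∷ W)) ×-dec T? (f (inside ∷ e)))
                    λ e (e⊆W , _) → contradiction (e⊆W here) λ ()) ⟩
  countInside W (f ∘ (outside ∷_)) + 0                 ≡⟨ +-identityʳ _ ⟩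
  countInside W (f ∘ (outside ∷_))                     ∎
  where open ≡-Reasoning

countInside-inside : ∀ {n} (W : Subset n) f →
  countInside (inside ∷ W) f ≡ countInside W (f ∘ (outside ∷_)) + countInside W (f ∘ (inside ∷_))
countInside-inside W f = trans
  (countSubsets-suc (λ e → (e ⊆? (inside ∷ W)) ×-dec T? (f e)))
  (cong₂ _+_ (countSubsets-≐ _ (λ e → (e ⊆? W) ×-dec T? (f (outside ∷ e)))
                ( (λ (e⊆W , fe) → (λ {x} → drop-∷-⊆ e⊆W {x}) , fe)
                , (λ (e⊆W , fe) → (λ {x} → out⊆ e⊆W {x}) , fe)))
             (countSubsets-≐ _ (λ e → (e ⊆? W) ×-dec T? (f (inside ∷ e)))
                ( (λ (e⊆W , fe) → (λ {x} → drop-∷-⊆ e⊆W {x}) , fe)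
                , (λ (e⊆W , fe) → (λ {x} → in⊆in e⊆W {x}) , fe))))

-- The vertices of `W` are renumbered in increasing order; `embed` translates sets of new labels
-- back.
embed : ∀ {n} (W : Subset n) → Subset ∣ W ∣ → Subset n
embed []            e       = []
embed (outside ∷ W) e       = outside ∷ embed W e
embed (inside  ∷ W) (x ∷ e) = x ∷ embed W e

∣embed∣ : ∀ {n} (W : Subset n) e → ∣ embed W e ∣ ≡ ∣ e ∣
∣embed∣ []            []            = refl
∣embed∣ (outside ∷ W) e             = ∣embed∣ W e
∣embed∣ (inside  ∷ W) (outside ∷ e) = ∣embed∣ W e
∣embed∣ (inside  ∷ W) (inside  ∷ e) = cong suc (∣embed∣ W e)

embed-⊆ : ∀ {n} (W : Subset n) e → embed W e ⊆ W
embed-⊆ (outside ∷ W) e             (there x∈) = there (embed-⊆ W e x∈)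
embed-⊆ (inside  ∷ W) (inside  ∷ e) here       = here
embed-⊆ (inside  ∷ W) (_ ∷ e)       (there x∈) = there (embed-⊆ W e x∈)

-- The image of `embed W` is exactly the family of subsets of `W`, each hit once. When `∣ W ∣` is 3
-- or 4, counting thus becomes a finite evaluation.
countInside-embed : ∀ {n} (W : Subset n) f → countInside W f ≡ countSubsets (T? ∘ f ∘ embed W)
countInside-embed []            f with f []
... | true  = refl
... | false = refl
countInside-embed (outside ∷ W) f =
  trans (countInside-outside W f) (countInside-embed W (f ∘ (outside ∷_)))
countInside-embed (inside ∷ W)  f = begin
  countInside (inside ∷ W) f
    ≡⟨ countInside-inside W f ⟩
  countInside W (f ∘ (outside ∷_)) + countInside W (f ∘ (inside ∷_))
    ≡⟨ cong₂ _+_ (countInside-embed W _) (countInside-embed W _) ⟩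
  countSubsets (T? ∘ f ∘ (outside ∷_) ∘ embed W) + countSubsets (T? ∘ f ∘ (inside ∷_) ∘ embed W)
    ≡⟨ sym (countSubsets-suc (T? ∘ f ∘ embed (inside ∷ W))) ⟩
  countSubsets (T? ∘ f ∘ embed (inside ∷ W)) ∎
  where open ≡-Reasoning

-- Ramsey's theorem and the lower bound

-- A Boolean colour treats cliques and cocliques alike, and `f` may be a link, which is not packaged
-- as an `RGraph`.
Mono : ∀ {n} → (Subset n → Bool) → ℕ → Bool → Subset n → Set
Mono f r b S = ∀ e → e ⊆ S → ∣ e ∣ ≡ r → f e ≡ b

Mono-⊥ : ∀ {n} (f : Subset n → Bool) r b → Mono f (suc r) b ⊥
Mono-⊥ {n} f r b e e⊆⊥ ∣e∣≡ with () ← subst₂ _≤_ ∣e∣≡ (∣⊥∣≡0 n) (p⊆q⇒∣p∣≤∣q∣ e⊆⊥)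

Mono-outside : ∀ {n} (f : Subset (suc n) → Bool) r b {S : Subset n} →
               Mono (f ∘ (outside ∷_)) r b S → Mono f r b (outside ∷ S)
Mono-outside f r b mono (outside ∷ e) e⊆ = mono e (drop-∷-⊆ e⊆)
Mono-outside f r b mono (inside  ∷ e) e⊆ = contradiction (e⊆ here) λ ()

∣∩∣+∣∩∁∣ : ∀ {n} (S C : Subset n) → ∣ S ∩ C ∣ + ∣ S ∩ ∁ C ∣ ≡ ∣ S ∣
∣∩∣+∣∩∁∣ []            []            = refl
∣∩∣+∣∩∁∣ (outside ∷ S) (_       ∷ C) = ∣∩∣+∣∩∁∣ S C
∣∩∣+∣∩∁∣ (inside  ∷ S) (outside ∷ C) = trans (+-suc ∣ S ∩ C ∣ _) (cong suc (∣∩∣+∣∩∁∣ S C))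
∣∩∣+∣∩∁∣ (inside  ∷ S) (inside  ∷ C) = cong suc (∣∩∣+∣∩∁∣ S C)

∣p∣≡0⇒p≡⊥ : ∀ {n} (p : Subset n) → ∣ p ∣ ≡ 0 → p ≡ ⊥
∣p∣≡0⇒p≡⊥ []            _  = refl
∣p∣≡0⇒p≡⊥ (outside ∷ p) eq = cong (outside ∷_) (∣p∣≡0⇒p≡⊥ p eq)

∣p∣≡1⇒p≡⁅x⁆ : ∀ {n} (p : Subset n) → ∣ p ∣ ≡ 1 → ∃[ x ] p ≡ ⁅ x ⁆
∣p∣≡1⇒p≡⁅x⁆ (inside  ∷ p) eq = zero , cong (inside ∷_) (∣p∣≡0⇒p≡⊥ p (suc-injective eq))
∣p∣≡1⇒p≡⁅x⁆ (outside ∷ p) eq with x , p≡ ← ∣p∣≡1⇒p≡⁅x⁆ p eq = suc x , cong (outside ∷_) p≡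

-- If both parts had at most m - 1 elements, then 1 + x + y would be at most 2m - 1. The `suc`
-- stands for the vertex whose neighbours and non-neighbours are being separated.
half-≤ : ∀ m x y → 2 * m ≤ suc (x + y) → m ≤ x ⊎ m ≤ y
half-≤ m x y le with m ≤? x | m ≤? y
... | yes m≤x | _       = inj₁ m≤x
... | no _    | yes m≤y = inj₂ m≤y
... | no m≰x  | no m≰y  = contradiction le (<⇒≱ (begin-strict
  suc (x + y)     <⟨ ≤-reflexive (cong suc (sym (+-suc x y))) ⟩
  suc x + suc y   ≤⟨ +-mono-≤ (≰⇒> m≰x) (≰⇒> m≰y) ⟩
  m + m           ≡⟨ cong (m +_) (sym (+-identityʳ m)) ⟩
  2 * m           ∎))
  where open ≤-Reasoning

Mono-inside : ∀ {n} (g : Subset (suc n) → Bool) b {S : Subset n} →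
              (∀ u → u ∈ S → g (inside ∷ ⁅ u ⁆) ≡ b) →
              Mono (g ∘ (outside ∷_)) 2 b S → Mono g 2 b (inside ∷ S)
Mono-inside g b star mono (outside ∷ p) p⊆ ∣p∣ = mono p (drop-∷-⊆ p⊆) ∣p∣
Mono-inside g b star mono (inside  ∷ p) p⊆ ∣p∣
  with u , refl ← ∣p∣≡1⇒p≡⁅x⁆ p (suc-injective ∣p∣) = star u (drop-∷-⊆ p⊆ (x∈⁅x⁆ u))

neighbours : ∀ {n} → (Subset (suc n) → Bool) → Subset n
neighbours g = tabulate (λ u → g (inside ∷ ⁅ u ⁆))

∈neighbours : ∀ {n} (g : Subset (suc n) → Bool) u → u ∈ neighbours g → g (inside ∷ ⁅ u ⁆) ≡ true
∈neighbours g u u∈ = trans (sym (lookup∘tabulate _ u)) ([]=⇒lookup u∈)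

∈∁neighbours : ∀ {n} (g : Subset (suc n) → Bool) u → u ∈ ∁ (neighbours g) → g (inside ∷ ⁅ u ⁆) ≡ false
∈∁neighbours g u u∈ = ¬-not λ adj →
  x∈∁p⇒x∉p u∈ (lookup⇒[]= u _ (trans (lookup∘tabulate _ u) adj))

MonoSubset : ∀ {n} → ℕ → ℕ → (Subset n → Bool) → Subset n → Set
MonoSubset a b g S = ∃[ T ] T ⊆ S × (∣ T ∣ ≡ a × Mono g 2 true T ⊎ ∣ T ∣ ≡ b × Mono g 2 false T)

-- Recursion over the vertices. If vertex 0 is in `S`, half of the bound survives among its
-- neighbours, where `a` drops by one, or among its non-neighbours, where `b` does. Only the values
-- of `g` on pairs matter, so a link can be supplied as it is.
ramsey : ∀ n a b (g : Subset n → Bool) (S : Subset n) → 2 ^ (a + b) ≤ ∣ S ∣ → MonoSubset a b g S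
ramsey n zero    b       g S _ = ⊥ , ⊆-min S , inj₁ (∣⊥∣≡0 n , Mono-⊥ g 1 true)
ramsey n (suc a) zero    g S _ = ⊥ , ⊆-min S , inj₂ (∣⊥∣≡0 n , Mono-⊥ g 1 false)
ramsey zero (suc a) (suc b) g [] le = contradiction le (<⇒≱ (m^n>0 2 (suc a + suc b)))
ramsey (suc n) (suc a) (suc b) g (outside ∷ S) le
  with ramsey n (suc a) (suc b) (g ∘ (outside ∷_)) S le
... | T , T⊆S , inj₁ (∣T∣ , mono) = outside ∷ T , out⊆ T⊆S , inj₁ (∣T∣ , Mono-outside g 2 true mono)
... | T , T⊆S , inj₂ (∣T∣ , mono) = outside ∷ T , out⊆ T⊆S , inj₂ (∣T∣ , Mono-outside g 2 false mono)
ramsey (suc n) (suc a) (suc b) g (inside ∷ S) le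
  with half-≤ (2 ^ (a + suc b)) ∣ S ∩ neighbours g ∣ ∣ S ∩ ∁ (neighbours g) ∣
         (subst (λ m → 2 ^ (suc a + suc b) ≤ suc m) (sym (∣∩∣+∣∩∁∣ S (neighbours g))) le)
... | inj₁ large = extend (ramsey n a (suc b) (g ∘ (outside ∷_)) A large)
  where
  A = S ∩ neighbours g
  extend : MonoSubset a (suc b) (g ∘ (outside ∷_)) A → MonoSubset (suc a) (suc b) g (inside ∷ S)
  extend (T , T⊆A , inj₁ (∣T∣ , mono)) =
    inside ∷ T , in⊆in (p∩q⊆p S _ ∘ T⊆A) ,
    inj₁ (cong suc ∣T∣ , Mono-inside g true (λ u u∈T → ∈neighbours g u (p∩q⊆q S _ (T⊆A u∈T))) mono)
  extend (T , T⊆A , inj₂ (∣T∣ , mono)) =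
    outside ∷ T , out⊆ (p∩q⊆p S _ ∘ T⊆A) , inj₂ (∣T∣ , Mono-outside g 2 false mono)
... | inj₂ large = extend (ramsey n (suc a) b (g ∘ (outside ∷_)) B
                             (subst (λ m → 2 ^ m ≤ ∣ B ∣) (+-suc a b) large))
  where
  B = S ∩ ∁ (neighbours g)
  extend : MonoSubset (suc a) b (g ∘ (outside ∷_)) B → MonoSubset (suc a) (suc b) g (inside ∷ S)
  extend (T , T⊆B , inj₁ (∣T∣ , mono)) =
    outside ∷ T , out⊆ (p∩q⊆p S _ ∘ T⊆B) , inj₁ (∣T∣ , Mono-outside g 2 true mono)
  extend (T , T⊆B , inj₂ (∣T∣ , mono)) =
    inside ∷ T , in⊆in (p∩q⊆p S _ ∘ T⊆B) ,
    inj₂ (cong suc ∣T∣ , Mono-inside g false (λ u u∈T → ∈∁neighbours g u (p∩q⊆q S _ (T⊆B u∈T))) mono)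

-- Links in two-graphs and the lower bound on n-vertex homogeneous sets

TwoGraphPairs : Pred (ℕ × ℕ) 0ℓ
TwoGraphPairs = ｛ (4 , 1) ｝ ∪ ｛ (4 , 3) ｝

p⊆q∧∣p∣≡∣q∣⇒p≡q : ∀ {n} (p q : Subset n) → p ⊆ q → ∣ p ∣ ≡ ∣ q ∣ → p ≡ q
p⊆q∧∣p∣≡∣q∣⇒p≡q []            []            p⊆q eq = refl
p⊆q∧∣p∣≡∣q∣⇒p≡q (outside ∷ p) (outside ∷ q) p⊆q eq = cong (outside ∷_) (p⊆q∧∣p∣≡∣q∣⇒p≡q p q (drop-∷-⊆ p⊆q) eq)
p⊆q∧∣p∣≡∣q∣⇒p≡q (outside ∷ p) (inside  ∷ q) p⊆q eq =
  contradiction (p⊆q⇒∣p∣≤∣q∣ (drop-∷-⊆ p⊆q)) (<⇒≱ (≤-reflexive (sym eq)))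
p⊆q∧∣p∣≡∣q∣⇒p≡q (inside  ∷ p) (outside ∷ q) p⊆q eq = contradiction (p⊆q here) λ ()
p⊆q∧∣p∣≡∣q∣⇒p≡q (inside  ∷ p) (inside  ∷ q) p⊆q eq =
  cong (inside ∷_) (p⊆q∧∣p∣≡∣q∣⇒p≡q p q (drop-∷-⊆ p⊆q) (suc-injective eq))

-- Inside `W` the function depends on cardinality alone, so `W` may be replaced by any set of `m`
-- vertices. With `m` a numeral the right-hand side evaluates.
countInside-size : ∀ {n m} (W : Subset n) → ∣ W ∣ ≡ m → ∀ (f : Subset n → Bool) (h : ℕ → Bool) →
                   (∀ e → e ⊆ W → f e ≡ h ∣ e ∣) →
                   countInside W f ≡ countSubsets {m} (λ e → T? (h ∣ e ∣))
countInside-size W refl f h f≡h = trans (countInside-embed W f)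
  (countSubsets-≗ _ _ λ e → trans (f≡h _ (embed-⊆ W e)) (cong h (∣embed∣ W e)))

uniform-≢ : ∀ {r n} (H : RGraph r n) e → ∣ e ∣ ≢ r → isEdge H e ≡ false
uniform-≢ H e ∣e∣≢r = ¬-not λ edge → ∣e∣≢r (uniform H e (subst T (sym edge) _))

onSize : ℕ → Bool → ℕ → Bool
onSize r c k = does (k ≟ r) ∧ c

onSize-≡ : ∀ {r k} c → k ≡ r → onSize r c k ≡ c
onSize-≡ {r} {k} c k≡r = cong (_∧ c) (dec-true (k ≟ r) k≡r)

onSize-≢ : ∀ {r k} c → k ≢ r → onSize r c k ≡ false
onSize-≢ {r} {k} c k≢r = cong (_∧ c) (dec-false (k ≟ r) k≢r)

-- For a triple e ⊆ S, the other three triples of {v} ∪ e contain v and so have colour b; if e had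
-- the other colour, the four vertices would span exactly 1 or 3 edges.
link-Mono : ∀ {n} (H : RGraph 3 (suc n)) → IsFree H TwoGraphPairs → ∀ b {S : Subset n} →
            Mono (isEdge H ∘ (inside ∷_)) 2 b S → Mono (isEdge H) 3 b (inside ∷ S)
link-Mono H free b mono (inside ∷ p) p⊆ ∣p∣ = mono p (drop-∷-⊆ p⊆) (suc-injective ∣p∣)
link-Mono H free b mono (outside ∷ e) e⊆ ∣e∣ = agree b (isEdge H (outside ∷ e)) refl refl
  where
  -- Here `c` is `b` and `x` is the colour of `e`. Once both are constants, the two counts over the
  -- subsets of a three-element set evaluate.
  agree : ∀ c x → c ≡ b → isEdge H (outside ∷ e) ≡ x → x ≡ b
  base : ∀ p → p ⊆ e → isEdge H (outside ∷ p) ≡ onSize 3 (isEdge H (outside ∷ e)) ∣ p ∣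
  base p p⊆e with ∣ p ∣ ≟ 3
  ... | no ∣p∣≢3 = trans (uniform-≢ H (outside ∷ p) ∣p∣≢3) (sym (onSize-≢ _ ∣p∣≢3))
  ... | yes ∣p∣≡3 = trans
    (cong (isEdge H ∘ (outside ∷_)) (p⊆q∧∣p∣≡∣q∣⇒p≡q p e p⊆e (trans ∣p∣≡3 (sym ∣e∣))))
    (sym (onSize-≡ _ ∣p∣≡3))
  star : ∀ p → p ⊆ e → isEdge H (inside ∷ p) ≡ onSize 2 b ∣ p ∣
  star p p⊆e with ∣ p ∣ ≟ 2
  ... | no ∣p∣≢2 = trans (uniform-≢ H (inside ∷ p) (∣p∣≢2 ∘ suc-injective)) (sym (onSize-≢ _ ∣p∣≢2))
  ... | yes ∣p∣≡2 = trans (mono p (drop-∷-⊆ e⊆ ∘ p⊆e) ∣p∣≡2) (sym (onSize-≡ _ ∣p∣≡2))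
  count : countInside (inside ∷ e) (isEdge H) ≡
          countSubsets {3} (λ p → T? (onSize 3 (isEdge H (outside ∷ e)) ∣ p ∣)) +
          countSubsets {3} (λ p → T? (onSize 2 b ∣ p ∣))
  count = trans (countInside-inside e (isEdge H))
    (cong₂ _+_ (countInside-size e ∣e∣ _ (onSize 3 _) base) (countInside-size e ∣e∣ _ (onSize 2 b) star))
  agree true  true  refl x≡ = refl
  agree false false refl x≡ = refl
  agree true  false refl x≡ = contradiction
    (inside ∷ e , cong suc ∣e∣ , trans count (cong (λ x → countSubsets {3} (λ p → T? (onSize 3 x ∣ p ∣)) + 3) x≡))
    (free (4 , 3) (inj₂ refl))
  agree false true  refl x≡ = contradiction
    (inside ∷ e , cong suc ∣e∣ , trans count (cong (λ x → countSubsets {3} (λ p → T? (onSize 3 x ∣ p ∣)) + 0) x≡))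
    (free (4 , 1) (inj₁ refl))

Mono⇒homogeneous : ∀ {r n} (H : RGraph r n) b {S : Subset n} → Mono (isEdge H) r b S → IsHomogeneous H S
Mono⇒homogeneous H true  mono = inj₁ λ e e⊆S ∣e∣ → subst T (sym (mono e e⊆S ∣e∣)) _
Mono⇒homogeneous H false mono = inj₂ λ e e⊆S ∣e∣ edge → subst T (mono e e⊆S ∣e∣) edge

homogeneous⇒Mono : ∀ {r n} (H : RGraph r n) {S : Subset n} → IsHomogeneous H S → ∃[ b ] Mono (isEdge H) r b S
homogeneous⇒Mono H (inj₁ clique)   = true  , λ e e⊆S ∣e∣ → Equivalence.to T-≡ (clique e e⊆S ∣e∣)
homogeneous⇒Mono H (inj₂ coclique) = false , λ e e⊆S ∣e∣ → ¬-not (coclique e e⊆S ∣e∣ ∘ Equivalence.from T-≡)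

-- Otherwise the link of vertex 0 has at least 2 ^ (2 h) vertices and hence a monochromatic set of
-- size `h`; adding vertex 0 gives a homogeneous set of size h + 1.
free⇒n≤4^h : ∀ {n} (H : RGraph 3 n) {h} → IsFree H TwoGraphPairs → Is-h H h → n ≤ 2 ^ (h + h)
free⇒n≤4^h {zero}  H     free _ = z≤n
free⇒n≤4^h {suc n} H {h} free (_ , max) = ≮⇒≥ λ 2^<n → large
  (ramsey n h h (isEdge H ∘ (inside ∷_)) ⊤ (subst (2 ^ (h + h) ≤_) (sym (∣⊤∣≡n n)) (s≤s⁻¹ 2^<n)))
  where
  tooLarge : ∀ b {T : Subset n} → ∣ T ∣ ≡ h → ¬ Mono (isEdge H ∘ (inside ∷_)) 2 b T
  tooLarge b {T} ∣T∣ mono = 1+n≰n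
    (max (suc h) (inside ∷ T , Mono⇒homogeneous H b (link-Mono H free b mono) , cong suc ∣T∣))
  large : ¬ MonoSubset h h (isEdge H ∘ (inside ∷_)) ⊤
  large (T , _ , inj₁ (∣T∣ , mono)) = tooLarge true  ∣T∣ mono
  large (T , _ , inj₂ (∣T∣ , mono)) = tooLarge false ∣T∣ mono

-- The two-graph of a graph

infixr 5 _∷_

-- Strictly triangular adjacency matrices: the head row joins vertex 0 to the remaining vertices.
data Graph : ℕ → Set where
  []  : Graph 0
  _∷_ : ∀ {n} → Subset n → Graph n → Graph (suc n)

degreeParity : ∀ {n} → Subset n → Subset n → Bool
degreeParity []      []            = false
degreeParity (x ∷ R) (outside ∷ e) = degreeParity R e
degreeParity (x ∷ R) (inside  ∷ e) = x xor degreeParity R e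

-- The parity of the number of edges of the graph inside a vertex set.
edgeParity : ∀ {n} → Graph n → Subset n → Bool
edgeParity []      []            = false
edgeParity (R ∷ G) (outside ∷ e) = edgeParity G e
edgeParity (R ∷ G) (inside  ∷ e) = degreeParity R e xor edgeParity G e

oddTriples : ∀ {n} → Graph n → RGraph 3 n
oddTriples G .isEdge e    = onSize 3 (edgeParity G e) ∣ e ∣
oddTriples G .uniform e t = ≡ᵇ⇒≡ ∣ e ∣ 3 (proj₁ (Equivalence.to T-∧ t))

restrictRow : ∀ {n} (W : Subset n) → Subset n → Subset ∣ W ∣
restrictRow []            []      = []
restrictRow (outside ∷ W) (x ∷ R) = restrictRow W R
restrictRow (inside  ∷ W) (x ∷ R) = x ∷ restrictRow W R

restrict : ∀ {n} (W : Subset n) → Graph n → Graph ∣ W ∣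
restrict []            []      = []
restrict (outside ∷ W) (R ∷ G) = restrict W G
restrict (inside  ∷ W) (R ∷ G) = restrictRow W R ∷ restrict W G

degreeParity-restrict : ∀ {n} (W R : Subset n) e →
                        degreeParity R (embed W e) ≡ degreeParity (restrictRow W R) e
degreeParity-restrict []            []      []            = refl
degreeParity-restrict (outside ∷ W) (x ∷ R) e             = degreeParity-restrict W R e
degreeParity-restrict (inside  ∷ W) (x ∷ R) (outside ∷ e) = degreeParity-restrict W R e
degreeParity-restrict (inside  ∷ W) (x ∷ R) (inside  ∷ e) = cong (x xor_) (degreeParity-restrict W R e)

edgeParity-restrict : ∀ {n} (W : Subset n) G e → edgeParity G (embed W e) ≡ edgeParity (restrict W G) e
edgeParity-restrict []            []      []            = refl
edgeParity-restrict (outside ∷ W) (R ∷ G) e             = edgeParity-restrict W G e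
edgeParity-restrict (inside  ∷ W) (R ∷ G) (outside ∷ e) = edgeParity-restrict W G e
edgeParity-restrict (inside  ∷ W) (R ∷ G) (inside  ∷ e) =
  cong₂ _xor_ (degreeParity-restrict W R e) (edgeParity-restrict W G e)

-- The binomial coefficient n choose 2, which is the number of entries of a `Graph n`.
tri : ℕ → ℕ
tri zero    = 0
tri (suc n) = n + tri n

-- Coding a graph as one bit string, row after row, allows both exhaustive search and the choice of
-- the edges one bit at a time.
toGraph : ∀ n → Subset (tri n) → Graph n
toGraph zero    v = []
toGraph (suc n) v = take n v ∷ toGraph n (drop n v)

oddTriplesIn4 : Graph 4 → ℕ
oddTriplesIn4 G = countSubsets (T? ∘ isEdge (oddTriples G))

-- Each edge of a graph on four vertices lies in two of its four triples, so the four parities sum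
-- to zero. The proof evaluates all 2 ^ 6 graphs.
oddTriplesIn4-even : ∀ G → ¬ (oddTriplesIn4 G ≡ 1 ⊎ oddTriplesIn4 G ≡ 3)
oddTriplesIn4-even ((a ∷ b ∷ c ∷ []) ∷ (d ∷ e ∷ []) ∷ (f ∷ []) ∷ [] ∷ []) odd =
  toWitnessFalse {a? = anySubset? λ v → (oddTriplesIn4 (toGraph 4 v) ≟ 1) ⊎-dec (oddTriplesIn4 (toGraph 4 v) ≟ 3)}
    tt (a ∷ b ∷ c ∷ d ∷ e ∷ f ∷ [] , odd)

oddTriples-count : ∀ {n} (G : Graph n) (W : Subset n) →
                   countInside W (isEdge (oddTriples G)) ≡ countSubsets (T? ∘ isEdge (oddTriples (restrict W G)))
oddTriples-count G W = trans (countInside-embed W _)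
  (countSubsets-≗ _ _ λ e → cong₂ (onSize 3) (edgeParity-restrict W G e) (∣embed∣ W e))

oddTriples-free : ∀ {n} (G : Graph n) → IsFree (oddTriples G) TwoGraphPairs
oddTriples-free G (m , f) q (W , ∣W∣ , count) =
  even q (restrict W G) ∣W∣ (trans (sym (oddTriples-count G W)) count)
  where
  -- Since `l` is a variable, unlike `∣ W ∣`, matching on `refl` can set it to 4.
  even : ∀ {l} → TwoGraphPairs (m , f) → (K : Graph l) → l ≡ m → countSubsets (T? ∘ isEdge (oddTriples K)) ≢ f
  even (inj₁ refl) K refl = oddTriplesIn4-even K ∘ inj₁
  even (inj₂ refl) K refl = oddTriplesIn4-even K ∘ inj₂

-- Homogeneous sets of the odd triples

odd : ℕ → Bool
odd zero    = false
odd (suc n) = not (odd n)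

degreeParity-⊆ : ∀ {n} (R p : Subset n) → p ⊆ R → degreeParity R p ≡ odd ∣ p ∣
degreeParity-⊆ []      []            p⊆R = refl
degreeParity-⊆ (x ∷ R) (outside ∷ p) p⊆R = degreeParity-⊆ R p (drop-∷-⊆ p⊆R)
degreeParity-⊆ (x ∷ R) (inside  ∷ p) p⊆R with here ← p⊆R here = cong not (degreeParity-⊆ R p (drop-∷-⊆ p⊆R))

degreeParity-⊆∁ : ∀ {n} (R p : Subset n) → p ⊆ ∁ R → degreeParity R p ≡ false
degreeParity-⊆∁ []             []            p⊆∁ = refl
degreeParity-⊆∁ (x ∷ R)        (outside ∷ p) p⊆∁ = degreeParity-⊆∁ R p (drop-∷-⊆ p⊆∁)
degreeParity-⊆∁ (outside ∷ R)  (inside  ∷ p) p⊆∁ = degreeParity-⊆∁ R p (drop-∷-⊆ p⊆∁)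
degreeParity-⊆∁ (inside ∷ R)   (inside  ∷ p) p⊆∁ = contradiction (p⊆∁ here) λ ()

degreeParity-⊥ : ∀ {n} (R : Subset n) → degreeParity R ⊥ ≡ false
degreeParity-⊥ R = degreeParity-⊆∁ R ⊥ (⊆-min (∁ R))

edgeParity-⊥ : ∀ {n} (G : Graph n) → edgeParity G ⊥ ≡ false
edgeParity-⊥ []      = refl
edgeParity-⊥ (R ∷ G) = edgeParity-⊥ G

degreeParity-⁅⁆ : ∀ {n} (R : Subset n) u → degreeParity R ⁅ u ⁆ ≡ lookup R u
degreeParity-⁅⁆ (x ∷ R) zero    = trans (cong (x xor_) (degreeParity-⊥ R)) (xor-identityʳ x)
degreeParity-⁅⁆ (x ∷ R) (suc u) = degreeParity-⁅⁆ R u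

edgeParity-⁅⁆ : ∀ {n} (G : Graph n) u → edgeParity G ⁅ u ⁆ ≡ false
edgeParity-⁅⁆ (R ∷ G) zero    = cong₂ _xor_ (degreeParity-⊥ R) (edgeParity-⊥ G)
edgeParity-⁅⁆ (R ∷ G) (suc u) = edgeParity-⁅⁆ G u

-- For v ∈ S with neighbours R, the triple v ∪ p has the parity of the pair p whenever p lies
-- inside R or inside its complement.
splitHomogeneous : ∀ {n} (G : Graph n) b S → Mono (edgeParity G) 3 b S →
  ∃[ A ] ∃[ B ] Mono (edgeParity G) 2 b A × Mono (edgeParity G) 2 b B × ∣ S ∣ ≤ suc (∣ A ∣ + ∣ B ∣)
splitHomogeneous []      b []            mono = [] , [] , Mono-⊥ _ 1 b , Mono-⊥ _ 1 b , z≤n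
splitHomogeneous (R ∷ G) b (outside ∷ S) mono
  with A , B , monoA , monoB , le ← splitHomogeneous G b S (λ e e⊆S → mono (outside ∷ e) (out⊆ e⊆S))
  = outside ∷ A , outside ∷ B , Mono-outside _ 2 b monoA , Mono-outside _ 2 b monoB , le
-- Vertices outside the set have been skipped, so the head vertex is its least element and `R`
-- records its adjacency to all the others.
splitHomogeneous (R ∷ G) b (inside  ∷ S) mono =
  outside ∷ S ∩ R , outside ∷ S ∩ ∁ R ,
  Mono-outside _ 2 b (λ p p⊆ ∣p∣ → pair p (p∩q⊆p S R ∘ p⊆) ∣p∣
    (trans (degreeParity-⊆ R p (p∩q⊆q S R ∘ p⊆)) (cong odd ∣p∣))) ,
  Mono-outside _ 2 b (λ p p⊆ ∣p∣ → pair p (p∩q⊆p S (∁ R) ∘ p⊆) ∣p∣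
    (degreeParity-⊆∁ R p (p∩q⊆q S (∁ R) ∘ p⊆))) ,
  ≤-reflexive (cong suc (sym (∣∩∣+∣∩∁∣ S R)))
  where
  pair : ∀ p → p ⊆ S → ∣ p ∣ ≡ 2 → degreeParity R p ≡ false → edgeParity G p ≡ b
  pair p p⊆S ∣p∣ even = trans (cong (_xor edgeParity G p) (sym even))
    (mono (inside ∷ p) (in⊆in p⊆S) (cong suc ∣p∣))

shrink : ∀ {n} k (S : Subset n) → k ≤ ∣ S ∣ → ∃[ A ] ∣ A ∣ ≡ k × A ⊆ S
shrink {n} zero    S             _   = ⊥ , ∣⊥∣≡0 n , ⊆-min S
shrink     (suc k) (outside ∷ S) k≤ with A , ∣A∣ , A⊆S ← shrink (suc k) S k≤ = outside ∷ A , ∣A∣ , out⊆ A⊆S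
shrink     (suc k) (inside  ∷ S) k≤ with A , ∣A∣ , A⊆S ← shrink k S (s≤s⁻¹ k≤) = inside ∷ A , cong suc ∣A∣ , in⊆in A⊆S

-- Size exactly `k` is what the union bound counts; larger sets are excluded too, because
-- homogeneity passes to subsets.
NoMonoSubset : ∀ {n} → ℕ → Graph n → Set
NoMonoSubset k G = ∀ b S → ∣ S ∣ ≡ k → ¬ Mono (edgeParity G) 2 b S

oddTriples-homogeneous : ∀ {n k} (G : Graph n) → NoMonoSubset k G →
                         ∀ S → IsHomogeneous (oddTriples G) S → ∣ S ∣ < 2 * k
oddTriples-homogeneous {k = k} G none S hom
  with b , mono ← homogeneous⇒Mono (oddTriples G) hom
  with A , B , monoA , monoB , le ← splitHomogeneous G b S
         (λ e e⊆S ∣e∣ → trans (sym (onSize-≡ _ ∣e∣)) (mono e e⊆S ∣e∣))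
  = begin-strict
  ∣ S ∣                  ≤⟨ le ⟩
  -- Both parts have at most k - 1 elements, which leaves room for the vertex removed by the
  -- splitting.
  suc ∣ A ∣ + ∣ B ∣      <⟨ +-mono-≤-< (small A monoA) (small B monoB) ⟩
  k + k                  ≡⟨ cong (k +_) (sym (+-identityʳ k)) ⟩
  2 * k                  ∎
  where
  open ≤-Reasoning
  small : ∀ A → Mono (edgeParity G) 2 b A → ∣ A ∣ < k
  small A monoA = ≰⇒> λ k≤ → let T , ∣T∣ , T⊆A = shrink k A k≤ in
    none b T ∣T∣ λ p p⊆T → monoA p (T⊆A ∘ p⊆T)

-- Graphs without large homogeneous sets

-- A subcube of the cube of bit strings, with `nothing` marking the free coordinates. Every event to
-- be avoided has this form.
Template : ℕ → Set
Template = Vec (Maybe Bool)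

Matches : Maybe Bool → Bool → Set
Matches nothing  x = Unit
Matches (just b) x = x ≡ b

-- The number of bit strings matching a template.
weight : ∀ {N} → Template N → ℕ
weight []            = 1
weight (nothing ∷ t) = 2 * weight t
weight (just _  ∷ t) = weight t

totalWeight : ∀ {N} → List (Template N) → ℕ
totalWeight ts = sum (List.map weight ts)

-- Conditioning on the first bit: templates that demand the other value become impossible and are
-- dropped.
fixFirst : ∀ {N} → Bool → List (Template (suc N)) → List (Template N)
fixFirst b     []                       = []
fixFirst b     ((nothing    ∷ t) ∷ ts) = t ∷ fixFirst b ts
fixFirst true  ((just true  ∷ t) ∷ ts) = t ∷ fixFirst true ts
fixFirst true  ((just false ∷ t) ∷ ts) = fixFirst true ts
fixFirst false ((just true  ∷ t) ∷ ts) = fixFirst false ts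
fixFirst false ((just false ∷ t) ∷ ts) = t ∷ fixFirst false ts

-- The strings matching a template are sorted by their first bit; a free first entry contributes to
-- both sides.
totalWeight-fixFirst : ∀ {N} (ts : List (Template (suc N))) →
  totalWeight (fixFirst true ts) + totalWeight (fixFirst false ts) ≡ totalWeight ts
totalWeight-fixFirst [] = refl
totalWeight-fixFirst ((nothing ∷ t) ∷ ts) =
  trans (rearrange (weight t) (totalWeight (fixFirst true ts)) _) (cong (2 * weight t +_) (totalWeight-fixFirst ts))
  where
  rearrange : ∀ w x y → w + x + (w + y) ≡ 2 * w + (x + y)
  rearrange = solve-∀
totalWeight-fixFirst ((just true ∷ t) ∷ ts) =
  trans (+-assoc (weight t) _ _) (cong (weight t +_) (totalWeight-fixFirst ts))
totalWeight-fixFirst ((just false ∷ t) ∷ ts) =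
  trans (rearrange (totalWeight (fixFirst true ts)) (weight t) _) (cong (weight t +_) (totalWeight-fixFirst ts))
  where
  rearrange : ∀ x w y → x + (w + y) ≡ w + (x + y)
  rearrange = solve-∀

Avoids : ∀ {N} → Vec Bool N → Template N → Set
Avoids v t = ¬ Pointwise Matches t v

avoids-fixFirst : ∀ {N} b {v : Vec Bool N} ts → All (Avoids v) (fixFirst b ts) → All (Avoids (b ∷ v)) ts
avoids-fixFirst b     []                      []       = []
avoids-fixFirst b     ((nothing    ∷ t) ∷ ts) (a ∷ as) = (λ { (_ ∷ m) → a m }) ∷ avoids-fixFirst b ts as
avoids-fixFirst true  ((just true  ∷ t) ∷ ts) (a ∷ as) = (λ { (_ ∷ m) → a m }) ∷ avoids-fixFirst true ts as
avoids-fixFirst true  ((just false ∷ t) ∷ ts) as       = (λ { (() ∷ _) }) ∷ avoids-fixFirst true ts as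
avoids-fixFirst false ((just true  ∷ t) ∷ ts) as       = (λ { (() ∷ _) }) ∷ avoids-fixFirst false ts as
avoids-fixFirst false ((just false ∷ t) ∷ ts) (a ∷ as) = (λ { (_ ∷ m) → a m }) ∷ avoids-fixFirst false ts as

half-< : ∀ m x y → x + y < 2 * m → x < m ⊎ y < m
half-< m x y lt with x <? m | y <? m
... | yes x<m | _       = inj₁ x<m
... | no _    | yes y<m = inj₂ y<m
... | no x≮m  | no y≮m  = contradiction lt (≤⇒≯
  (subst (_≤ x + y) (cong (m +_) (sym (+-identityʳ m))) (+-mono-≤ (≮⇒≥ x≮m) (≮⇒≥ y≮m))))

-- Method of conditional expectations: one of the two values of the first bit keeps the total
-- weight below the number of completions.
avoidAll : ∀ N (ts : List (Template N)) → totalWeight ts < 2 ^ N → ∃[ v ] All (Avoids v) ts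
avoidAll zero    []        _  = [] , []
avoidAll zero    ([] ∷ ts) lt = contradiction lt (≤⇒≯ (s≤s z≤n))
avoidAll (suc N) ts        lt
  with half-< (2 ^ N) _ _ (subst (_< 2 ^ suc N) (sym (totalWeight-fixFirst ts)) lt)
... | inj₁ lt₁ with v , avoids ← avoidAll N (fixFirst true ts) lt₁ = true ∷ v , avoids-fixFirst true ts avoids
... | inj₂ lt₂ with v , avoids ← avoidAll N (fixFirst false ts) lt₂ = false ∷ v , avoids-fixFirst false ts avoids

-- Homogeneous sets as templates

rowTemplate : ∀ {n} → Bool → Subset n → Template n
rowTemplate b = Vec.map (λ x → if x then just b else nothing)

-- The event that all pairs inside `S` have colour `b`, in the row order of `toGraph`. The row of a
-- vertex outside `S` is free; that of a vertex in `S` is fixed at the later elements of `S`.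
template : ∀ {n} → Bool → Subset n → Template (tri n)
template         b []            = []
template {suc n} b (outside ∷ S) = replicate n nothing ++ template b S
template         b (inside  ∷ S) = rowTemplate b S ++ template b S

weight-blank : ∀ n {N} (t : Template N) → weight (replicate n nothing ++ t) ≡ 2 ^ n * weight t
weight-blank zero    t = sym (*-identityˡ _)
weight-blank (suc n) t = trans (cong (2 *_) (weight-blank n t)) (sym (*-assoc 2 (2 ^ n) _))

-- The row fixes `∣ S ∣` of its `n` bits. Multiplying instead of dividing keeps the identity within
-- the naturals.
weight-rowTemplate : ∀ {n N} b (S : Subset n) (t : Template N) →
                     weight (rowTemplate b S ++ t) * 2 ^ ∣ S ∣ ≡ 2 ^ n * weight t
weight-rowTemplate b []            t = trans (*-identityʳ _) (sym (*-identityˡ _))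
weight-rowTemplate {suc n} b (outside ∷ S) t = begin
  2 * w * 2 ^ ∣ S ∣     ≡⟨ *-assoc 2 w _ ⟩
  2 * (w * 2 ^ ∣ S ∣)   ≡⟨ cong (2 *_) (weight-rowTemplate b S t) ⟩
  2 * (2 ^ n * weight t) ≡⟨ sym (*-assoc 2 (2 ^ n) _) ⟩
  2 * 2 ^ n * weight t  ∎
  where
  open ≡-Reasoning
  w = weight (rowTemplate b S ++ t)
weight-rowTemplate {suc n} b (inside ∷ S) t = begin
  w * (2 * 2 ^ ∣ S ∣)   ≡⟨ swap w (2 ^ ∣ S ∣) ⟩
  2 * (w * 2 ^ ∣ S ∣)   ≡⟨ cong (2 *_) (weight-rowTemplate b S t) ⟩
  2 * (2 ^ n * weight t) ≡⟨ sym (*-assoc 2 (2 ^ n) _) ⟩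
  2 * 2 ^ n * weight t  ∎
  where
  open ≡-Reasoning
  w = weight (rowTemplate b S ++ t)
  swap : ∀ x y → x * (2 * y) ≡ 2 * (x * y)
  swap = solve-∀

-- In probabilistic terms, a given `S` has all its pairs of colour `b` with probability 1 / 2 ^
-- `tri ∣ S ∣`.
weight-template : ∀ {n} b (S : Subset n) → weight (template b S) * 2 ^ tri ∣ S ∣ ≡ 2 ^ tri n
weight-template b [] = refl
weight-template {suc n} b (outside ∷ S) = begin
  weight (replicate n nothing ++ template b S) * 2 ^ tri ∣ S ∣
    ≡⟨ cong (_* 2 ^ tri ∣ S ∣) (weight-blank n (template b S)) ⟩
  2 ^ n * weight (template b S) * 2 ^ tri ∣ S ∣
    ≡⟨ *-assoc (2 ^ n) _ _ ⟩
  2 ^ n * (weight (template b S) * 2 ^ tri ∣ S ∣)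
    ≡⟨ cong (2 ^ n *_) (weight-template b S) ⟩
  2 ^ n * 2 ^ tri n
    ≡⟨ sym (^-distribˡ-+-* 2 n (tri n)) ⟩
  2 ^ (n + tri n) ∎
  where open ≡-Reasoning
weight-template {suc n} b (inside ∷ S) = begin
  w * 2 ^ (∣ S ∣ + tri ∣ S ∣)              ≡⟨ cong (w *_) (^-distribˡ-+-* 2 ∣ S ∣ _) ⟩
  w * (2 ^ ∣ S ∣ * 2 ^ tri ∣ S ∣)          ≡⟨ sym (*-assoc w _ _) ⟩
  w * 2 ^ ∣ S ∣ * 2 ^ tri ∣ S ∣            ≡⟨ cong (_* 2 ^ tri ∣ S ∣) (weight-rowTemplate b S (template b S)) ⟩
  2 ^ n * weight (template b S) * 2 ^ tri ∣ S ∣   ≡⟨ *-assoc (2 ^ n) _ _ ⟩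
  2 ^ n * (weight (template b S) * 2 ^ tri ∣ S ∣) ≡⟨ cong (2 ^ n *_) (weight-template b S) ⟩
  2 ^ n * 2 ^ tri n                        ≡⟨ sym (^-distribˡ-+-* 2 n (tri n)) ⟩
  2 ^ (n + tri n)                          ∎
  where
  open ≡-Reasoning
  w = weight (rowTemplate b S ++ template b S)

matches-blank : ∀ {n} (R : Subset n) → Pointwise Matches (replicate n nothing) R
matches-blank []      = []
matches-blank (x ∷ R) = tt ∷ matches-blank R

matches-row : ∀ {n} b (S R : Subset n) → (∀ u → u ∈ S → lookup R u ≡ b) → Pointwise Matches (rowTemplate b S) R
matches-row b []            []      _   = []
matches-row b (outside ∷ S) (x ∷ R) eq = tt ∷ matches-row b S R λ u u∈S → eq (suc u) (there u∈S)
matches-row b (inside  ∷ S) (x ∷ R) eq = eq zero here ∷ matches-row b S R λ u u∈S → eq (suc u) (there u∈S)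

-- The parity of a pair containing vertex 0 is the corresponding bit of the first row, since a
-- single vertex spans no edge. Hence a string avoiding the template codes a graph in which `S` is
-- not homogeneous of colour `b`.
matches-template : ∀ n b (S : Subset n) v → Mono (edgeParity (toGraph n v)) 2 b S → Pointwise Matches (template b S) v
matches-template zero    b []      []  mono = []
matches-template (suc n) b (s ∷ S) v mono =
  -- Writing `v` as its first row followed by the rest matches the concatenation in `template`.
  subst (Pointwise Matches _) (take++drop≡id n v) (rows s mono)
  where
  R = take n v
  rest : ∀ s → Mono (edgeParity (toGraph (suc n) v)) 2 b (s ∷ S) → Pointwise Matches (template b S) (drop n v)
  rest s mono = matches-template n b S (drop n v) λ p p⊆S → mono (outside ∷ p) (out⊆ p⊆S)
  rows : ∀ s → Mono (edgeParity (toGraph (suc n) v)) 2 b (s ∷ S) →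
         Pointwise Matches (template b (s ∷ S)) (R ++ drop n v)
  rows outside mono = Pointwise.++⁺ (matches-blank R) (rest outside mono)
  rows inside  mono = Pointwise.++⁺ (matches-row b S R star) (rest inside mono)
    where
    star : ∀ u → u ∈ S → lookup R u ≡ b
    star u u∈S = begin
      lookup R u                        ≡⟨ sym (xor-identityʳ _) ⟩
      lookup R u xor false              ≡⟨ cong₂ _xor_ (sym (degreeParity-⁅⁆ R u)) (sym (edgeParity-⁅⁆ G u)) ⟩
      degreeParity R ⁅ u ⁆ xor edgeParity G ⁅ u ⁆
        ≡⟨ mono (inside ∷ ⁅ u ⁆) (in⊆in λ x∈ → subst (_∈ S) (sym (x∈⁅y⁆⇒x≡y u x∈)) u∈S) (cong suc (∣⁅x⁆∣≡1 u)) ⟩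
      b                                 ∎
      where
      open ≡-Reasoning
      G = toGraph n (drop n v)

-- The union bound over the sets of size k

subsetsOfSize : ∀ n → ℕ → List (Subset n)
subsetsOfSize n       zero    = ⊥ ∷ []
subsetsOfSize zero    (suc k) = []
subsetsOfSize (suc n) (suc k) =
  List.map (outside ∷_) (subsetsOfSize n (suc k)) List.++ List.map (inside ∷_) (subsetsOfSize n k)

∈-subsetsOfSize : ∀ {n} k (S : Subset n) → ∣ S ∣ ≡ k → S ∈ₗ subsetsOfSize n k
∈-subsetsOfSize zero    S             eq = here (∣p∣≡0⇒p≡⊥ S eq)
∈-subsetsOfSize (suc k) (outside ∷ S) eq = ∈-++⁺ˡ (∈-map⁺ _ (∈-subsetsOfSize (suc k) S eq))
∈-subsetsOfSize (suc k) (inside  ∷ S) eq = ∈-++⁺ʳ _ (∈-map⁺ _ (∈-subsetsOfSize k S (suc-injective eq)))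

∣subsetsOfSize∣ : ∀ n k → All (λ S → ∣ S ∣ ≡ k) (subsetsOfSize n k)
∣subsetsOfSize∣ n       zero    = ∣⊥∣≡0 n ∷ []
∣subsetsOfSize∣ zero    (suc k) = []
∣subsetsOfSize∣ (suc n) (suc k) =
  All.++⁺ (All.map⁺ (∣subsetsOfSize∣ n (suc k))) (All.map⁺ (All.map (cong suc) (∣subsetsOfSize∣ n k)))

-- By Pascal's rule the induction step is n ^ (k + 1) + n ^ k = (n + 1) n ^ k, which is at most (n +
-- 1) ^ (k + 1).
length-subsetsOfSize : ∀ n k → length (subsetsOfSize n k) ≤ n ^ k
length-subsetsOfSize n       zero    = ≤-refl
length-subsetsOfSize zero    (suc k) = z≤n
length-subsetsOfSize (suc n) (suc k) = begin
  length (outs List.++ ins)        ≡⟨ List.length-++ outs ⟩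
  length outs + length ins         ≡⟨ cong₂ _+_ (List.length-map _ (subsetsOfSize n (suc k))) (List.length-map _ (subsetsOfSize n k)) ⟩
  length (subsetsOfSize n (suc k)) + length (subsetsOfSize n k)
                                   ≤⟨ +-mono-≤ (length-subsetsOfSize n (suc k)) (length-subsetsOfSize n k) ⟩
  n * n ^ k + n ^ k                ≡⟨ +-comm (n * n ^ k) _ ⟩
  suc n * n ^ k                    ≤⟨ *-monoʳ-≤ (suc n) (^-monoˡ-≤ k (n≤1+n n)) ⟩
  suc n * suc n ^ k                ∎
  where
  open ≤-Reasoning
  outs = List.map (outside ∷_) (subsetsOfSize n (suc k))
  ins  = List.map (inside ∷_) (subsetsOfSize n k)

totalWeight-templates : ∀ {n k} b (Ss : List (Subset n)) → All (λ S → ∣ S ∣ ≡ k) Ss →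
                        totalWeight (List.map (template b) Ss) * 2 ^ tri k ≡ length Ss * 2 ^ tri n
totalWeight-templates b []       []              = refl
totalWeight-templates b (S ∷ Ss) (refl ∷ sizes) = trans
  (*-distribʳ-+ (2 ^ tri ∣ S ∣) (weight (template b S)) _)
  (cong₂ _+_ (weight-template b S) (totalWeight-templates b Ss sizes))

monoTemplates : ∀ n k → Bool → List (Template (tri n))
monoTemplates n k b = List.map (template b) (subsetsOfSize n k)

-- After division by both powers of two, this bounds the expected number of pairs of a `k`-set and a
-- colour in which that set is monochromatic, in a uniformly random graph.
totalWeight-monoTemplates : ∀ n k →
  totalWeight (monoTemplates n k true List.++ monoTemplates n k false) * 2 ^ tri k ≤ 2 * n ^ k * 2 ^ tri n
totalWeight-monoTemplates n k = begin
  totalWeight (reds List.++ blues) * 2 ^ tri k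
    ≡⟨ cong (λ ws → sum ws * 2 ^ tri k) (List.map-++ weight reds blues) ⟩
  sum (List.map weight reds List.++ List.map weight blues) * 2 ^ tri k
    ≡⟨ cong (_* 2 ^ tri k) (sum-++ (List.map weight reds) _) ⟩
  (totalWeight reds + totalWeight blues) * 2 ^ tri k
    ≡⟨ *-distribʳ-+ (2 ^ tri k) (totalWeight reds) _ ⟩
  totalWeight reds * 2 ^ tri k + totalWeight blues * 2 ^ tri k
    ≡⟨ cong₂ _+_ (totalWeight-templates true Ss (∣subsetsOfSize∣ n k))
                 (totalWeight-templates false Ss (∣subsetsOfSize∣ n k)) ⟩
  length Ss * 2 ^ tri n + length Ss * 2 ^ tri n
    ≡⟨ double (length Ss) (2 ^ tri n) ⟩
  2 * length Ss * 2 ^ tri n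
    ≤⟨ *-monoˡ-≤ (2 ^ tri n) (*-monoʳ-≤ 2 (length-subsetsOfSize n k)) ⟩
  2 * n ^ k * 2 ^ tri n ∎
  where
  open ≤-Reasoning
  Ss    = subsetsOfSize n k
  reds  = monoTemplates n k true
  blues = monoTemplates n k false
  double : ∀ x y → x * y + x * y ≡ 2 * x * y
  double = solve-∀

-- Erdős' lower bound for Ramsey numbers: an expectation below 1 leaves a graph without any such
-- set, and `avoidAll` finds it.
noMonoSubset : ∀ n k → 2 * n ^ k < 2 ^ tri k → ∃[ G ] NoMonoSubset {n} k G
noMonoSubset n k few with avoidAll (tri n) (monoTemplates n k true List.++ monoTemplates n k false)
  (*-cancelʳ-< (2 ^ tri k) _ _ (≤-<-trans (totalWeight-monoTemplates n k)
    (subst (2 * n ^ k * 2 ^ tri n <_) (*-comm (2 ^ tri k) _) (*-monoˡ-< (2 ^ tri n) {{m^n≢0 2 (tri n)}} few))))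
... | v , avoids = toGraph n v , λ where
  true  S ∣S∣ mono → All.lookup avoids
    (∈-++⁺ˡ (∈-map⁺ (template true) (∈-subsetsOfSize k S ∣S∣))) (matches-template n true S v mono)
  false S ∣S∣ mono → All.lookup avoids
    (∈-++⁺ʳ (monoTemplates n k true) (∈-map⁺ (template false) (∈-subsetsOfSize k S ∣S∣))) (matches-template n false S v mono)

-- Existence of the extremal values

allSubsets? : ∀ {n} {P : Pred (Subset n) 0ℓ} → Decidable P → Dec (∀ S → P S)
allSubsets? P? = map′ (λ none S → decidable-stable (P? S) λ ¬PS → none (S , ¬PS))
                      (λ all (S , ¬PS) → ¬PS (all S))
                      (¬? (anySubset? (¬? ∘ P?)))

-- The search below reaches each function only up to pointwise equality, so the property must be
-- invariant under `≗`.
Extensional : ∀ {n} → Pred (Subset n → Bool) 0ℓ → Set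
Extensional P = ∀ {f g} → f ≗ g → P f → P g

glue : ∀ {n} → (Subset n → Bool) → (Subset n → Bool) → Subset (suc n) → Bool
glue f g (outside ∷ e) = f e
glue f g (inside  ∷ e) = g e

glue-cong : ∀ {n} {f f′ g g′ : Subset n → Bool} → f ≗ f′ → g ≗ g′ → glue f g ≗ glue f′ g′
glue-cong f≗ g≗ (outside ∷ e) = f≗ e
glue-cong f≗ g≗ (inside  ∷ e) = g≗ e

glue-η : ∀ {n} (f : Subset (suc n) → Bool) → f ≗ glue (f ∘ (outside ∷_)) (f ∘ (inside ∷_))
glue-η f (outside ∷ e) = refl
glue-η f (inside  ∷ e) = refl

-- A function on the subsets of n + 1 vertices is a pair of functions on the subsets of n vertices,
-- according to whether vertex 0 belongs. Two nested searches cover all pairs.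
anyFunction? : ∀ {n} {P : Pred (Subset n → Bool) 0ℓ} → Extensional P → Decidable P → Dec (∃ P)
anyFunction? {zero} {P} ext P? =
  map′ Sum.[ (λ p → _ , p) , (λ p → _ , p) ] constant (P? (λ _ → true) ⊎-dec P? (λ _ → false))
  where
  constant : ∃ P → P (λ _ → true) ⊎ P (λ _ → false)
  constant (f , p) with f [] in f[]
  ... | true  = inj₁ (ext (λ { [] → f[] }) p)
  ... | false = inj₂ (ext (λ { [] → f[] }) p)
anyFunction? {suc n} {P} ext P? =
  map′ (λ (f , g , p) → glue f g , p) (λ (f , p) → _ , _ , ext (glue-η f) p)
       (anyFunction? (λ f≗ (g , p) → g , ext (glue-cong f≗ (λ _ → refl)) p) λ f →
         anyFunction? (λ g≗ → ext (glue-cong (λ _ → refl) g≗)) λ g → P? (glue f g))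

module _ {P : Pred ℕ 0ℓ} (P? : Decidable P) where

  leastBelow : ∀ m → ∃ (IsMin P) ⊎ (∀ j → j < m → ¬ P j)
  leastBelow zero = inj₂ λ _ ()
  leastBelow (suc m) with leastBelow m
  ... | inj₁ least = inj₁ least
  ... | inj₂ none with P? m
  ...   | yes Pm = inj₁ (m , Pm , λ j Pj → ≮⇒≥ λ j<m → none j j<m Pj)
  ...   | no ¬Pm = inj₂ λ j j<1+m Pj →
            Sum.[ (λ j<m → none j j<m Pj) , (λ { refl → ¬Pm Pj }) ] (m<1+n⇒m<n∨m≡n j<1+m)

  least : ∀ {k} → P k → ∃ (IsMin P)
  least {k} Pk with leastBelow (suc k)
  ... | inj₁ min  = min
  ... | inj₂ none = contradiction Pk (none k ≤-refl)

  greatest : ∀ {k} m → P k → (∀ j → P j → j ≤ m) → ∃ (IsMax P)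
  greatest m Pk bound with P? m
  greatest m       Pk bound | yes Pm = m , Pm , bound
  greatest zero    Pk bound | no ¬P0 = contradiction (subst P (n≤0⇒n≡0 (bound _ Pk)) Pk) ¬P0
  greatest (suc m) Pk bound | no ¬Pm = greatest m Pk λ j Pj →
    s≤s⁻¹ (≤∧≢⇒< (bound j Pj) λ { refl → ¬Pm Pj })

homogeneous? : ∀ {r n} (H : RGraph r n) → Decidable (IsHomogeneous H)
homogeneous? {r} H S =
  allSubsets? (λ e → (e ⊆? S) →-dec (∣ e ∣ ≟ r) →-dec T? (isEdge H e)) ⊎-dec
  allSubsets? (λ e → (e ⊆? S) →-dec (∣ e ∣ ≟ r) →-dec ¬? (T? (isEdge H e)))

∃-Is-h : ∀ {r n} (H : RGraph (suc r) n) → ∃ (Is-h H)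
∃-Is-h {n = n} H = greatest
  (λ k → anySubset? λ S → homogeneous? H S ×-dec (∣ S ∣ ≟ k)) n
  -- The empty set starts the search: it is vacuously homogeneous because the uniformity is
  -- positive.
  (⊥ , Mono⇒homogeneous H true (Mono-⊥ (isEdge H) _ true) , ∣⊥∣≡0 n)
  (λ { _ (S , _ , refl) → ∣p∣≤n S })

-- Maximality speaks of all naturals `j`, but only sizes of sets in `P` occur, so checking the
-- finitely many subsets suffices.
isMax? : ∀ {n} {P : Pred (Subset n) 0ℓ} → Decidable P → Decidable (IsMax (λ k → ∃[ S ] (P S × ∣ S ∣ ≡ k)))
isMax? P? k = anySubset? (λ S → P? S ×-dec (∣ S ∣ ≟ k)) ×-dec
  map′ (λ bound → λ { j (S , PS , refl) → bound S PS }) (λ bound S PS → bound ∣ S ∣ (S , PS , refl))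
       (allSubsets? λ S → P? S →-dec (∣ S ∣ ≤? k))

induces? : ∀ {r n} (H : RGraph r n) mf → Dec (∃[ W ] InducesGraph H mf W)
induces? H (m , f) = anySubset? λ W → (∣ W ∣ ≟ m) ×-dec (length (inducedEdges H W) ≟ f)

free? : ∀ {r n} (H : RGraph r n) → Dec (IsFree H TwoGraphPairs)
free? H = map′ (λ { (¬1 , ¬3) → λ { _ (inj₁ refl) → ¬1 ; _ (inj₂ refl) → ¬3 } })
               (λ free → free (4 , 1) (inj₁ refl) , free (4 , 3) (inj₂ refl))
               (¬? (induces? H (4 , 1)) ×-dec ¬? (induces? H (4 , 3)))

module _ {r n : ℕ} (H K : RGraph r n) (H≗K : isEdge H ≗ isEdge K) where

  homogeneous-cong : ∀ S → IsHomogeneous H S → IsHomogeneous K S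
  homogeneous-cong S hom with b , mono ← homogeneous⇒Mono H hom =
    Mono⇒homogeneous K b λ e e⊆S ∣e∣ → trans (sym (H≗K e)) (mono e e⊆S ∣e∣)

  free-cong : ∀ {Q} → IsFree H Q → IsFree K Q
  free-cong free (m , f) q (W , ∣W∣ , count) = free (m , f) q (W , ∣W∣ , trans
    (countSubsets-≐ (λ e → (e ⊆? W) ×-dec T? (isEdge H e)) (λ e → (e ⊆? W) ×-dec T? (isEdge K e))
      ( (λ { {e} (e⊆W , t) → (λ {x} → e⊆W {x}) , subst T (H≗K e) t })
      , (λ { {e} (e⊆W , t) → (λ {x} → e⊆W {x}) , subst T (sym (H≗K e)) t }))) count)

Is-h-cong : ∀ {r n} (H K : RGraph r n) → isEdge H ≗ isEdge K → ∀ {k} → Is-h H k → Is-h K k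
Is-h-cong H K H≗K ((S , hom , ∣S∣) , max) =
  (S , homogeneous-cong H K H≗K S hom , ∣S∣) ,
  λ { j (T , homT , ∣T∣) → max j (T , homogeneous-cong K H (λ e → sym (H≗K e)) T homT , ∣T∣) }

-- The record is unpacked because only edge functions can be enumerated; the uniformity proof is
-- then quantified separately.
Realises : ∀ r n → ℕ → (Subset n → Bool) → Set
Realises r n k f = ∃[ u ] IsFree (H u) TwoGraphPairs × Is-h (H u) k
  where
  H : (∀ e → T (f e) → ∣ e ∣ ≡ r) → RGraph r n
  H u = record { isEdge = f ; uniform = u }

realises? : ∀ r n k → Decidable (Realises r n k)
realises? r n k f with allSubsets? (λ e → T? (f e) →-dec (∣ e ∣ ≟ r))
... | no ¬u = no (¬u ∘ proj₁)
-- Any uniformity proof will do: freeness and `Is-h` mention only the edge function.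
... | yes u = map′ (u ,_) proj₂ (free? H ×-dec isMax? (homogeneous? H) k)
  where
  H : RGraph r n
  H = record { isEdge = f ; uniform = u }

realises-ext : ∀ r n k → Extensional (Realises r n k)
realises-ext r n k {f} {g} f≗g (u , free , h) = v , free-cong H K f≗g free , Is-h-cong H K f≗g h
  where
  v : ∀ e → T (g e) → ∣ e ∣ ≡ r
  v e t = u e (subst T (sym (f≗g e)) t)
  H K : RGraph r n
  H = record { isEdge = f ; uniform = u }
  K = record { isEdge = g ; uniform = v }

-- Constructively a least element needs a decidable property; realisability of `k` is decided by
-- searching all edge functions, and `H` supplies one realised value.
∃-Is-hᵣ : ∀ {r n k} (H : RGraph r n) → IsFree H TwoGraphPairs → Is-h H k → ∃ (Is-hᵣ r n TwoGraphPairs)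
∃-Is-hᵣ {r} {n} H free h = least
  (λ k → map′ (λ (f , u , free , h) → record { isEdge = f ; uniform = u } , free , h)
              (λ (H , free , h) → isEdge H , uniform H , free , h)
              (anyFunction? (realises-ext r n k) (realises? r n k)))
  (H , free , h)

-- Logarithms

fraction-mono : ∀ p q a b → p * suc b ≤ q * suc a → (ℤ.+ p ℚ./ suc a) ℚ.≤ (ℤ.+ q ℚ./ suc b)
fraction-mono p q a b le = ℚ.toℚᵘ-cancel-≤ (begin
  ℚ.toℚᵘ (ℤ.+ p ℚ./ suc a)  ≃⟨ ℚ.toℚᵘ-fromℚᵘ (mkℚᵘ (ℤ.+ p) a) ⟩
  mkℚᵘ (ℤ.+ p) a            ≤⟨ ℚᵘ.*≤* (subst₂ ℤ._≤_ (ℤ.pos-* p (suc b)) (ℤ.pos-* q (suc a)) (ℤ.+≤+ le)) ⟩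
  mkℚᵘ (ℤ.+ q) b            ≃⟨ ℚᵘ.≃-sym (ℚ.toℚᵘ-fromℚᵘ (mkℚᵘ (ℤ.+ q) b)) ⟩
  ℚ.toℚᵘ (ℤ.+ q ℚ./ suc b)  ∎)
  where open ℚᵘ.≤-Reasoning

ι : ℕ → ℚ
ι n = ℤ.+ n ℚ./ 1

ι-mono : ∀ {m n} → m ≤ n → ι m ℚ.≤ ι n
ι-mono {m} {n} m≤n = fraction-mono m n 0 0 (*-monoˡ-≤ 1 m≤n)

ι-nonNeg : ∀ n → 0ℚ ℚ.≤ ι n
ι-nonNeg n = ι-mono {0} {n} z≤n

ι-* : ∀ m n → ι (m * n) ≡ ι m ℚ.* ι n
ι-* m n = ℚ.toℚᵘ-injective (begin
  ℚ.toℚᵘ (ι (m * n))                ≈⟨ ℚ.toℚᵘ-fromℚᵘ (mkℚᵘ (ℤ.+ (m * n)) 0) ⟩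
  mkℚᵘ (ℤ.+ (m * n)) 0                ≈⟨ ℚᵘ.*≡* (cong (ℤ._* ℤ.+ 1) (ℤ.pos-* m n)) ⟩
  mkℚᵘ (ℤ.+ m) 0 ℚᵘ.* mkℚᵘ (ℤ.+ n) 0    ≈⟨ ℚᵘ.*-cong (ℚᵘ.≃-sym (ℚ.toℚᵘ-fromℚᵘ (mkℚᵘ (ℤ.+ m) 0)))
        (ℚᵘ.≃-sym (ℚ.toℚᵘ-fromℚᵘ (mkℚᵘ (ℤ.+ n) 0))) ⟩
  ℚ.toℚᵘ (ι m) ℚᵘ.* ℚ.toℚᵘ (ι n)    ≈⟨ ℚᵘ.≃-sym (ℚ.toℚᵘ-homo-* (ι m) (ι n)) ⟩
  ℚ.toℚᵘ (ι m ℚ.* ι n)              ∎)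
  where open ℚᵘ.≃-Reasoning

ι-+ : ∀ m n → ι (m + n) ≡ ι m ℚ.+ ι n
ι-+ m n = ℚ.toℚᵘ-injective (begin
  ℚ.toℚᵘ (ι (m + n))                ≈⟨ ℚ.toℚᵘ-fromℚᵘ (mkℚᵘ (ℤ.+ (m + n)) 0) ⟩
  mkℚᵘ (ℤ.+ (m + n)) 0                ≈⟨ ℚᵘ.*≡* (cong (ℤ._* ℤ.+ 1) (cong₂ ℤ._+_ (sym (ℤ.*-identityʳ (ℤ.+ m))) (sym (ℤ.*-identityʳ (ℤ.+ n))))) ⟩
  mkℚᵘ (ℤ.+ m) 0 ℚᵘ.+ mkℚᵘ (ℤ.+ n) 0    ≈⟨ ℚᵘ.+-cong (ℚᵘ.≃-sym (ℚ.toℚᵘ-fromℚᵘ (mkℚᵘ (ℤ.+ m) 0)))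
        (ℚᵘ.≃-sym (ℚ.toℚᵘ-fromℚᵘ (mkℚᵘ (ℤ.+ n) 0))) ⟩
  ℚ.toℚᵘ (ι m) ℚᵘ.+ ℚ.toℚᵘ (ι n)    ≈⟨ ℚᵘ.≃-sym (ℚ.toℚᵘ-homo-+ (ι m) (ι n)) ⟩
  ℚ.toℚᵘ (ι m ℚ.+ ι n)              ∎)
  where open ℚᵘ.≃-Reasoning

-- The bound holds for each approximation, not only in the limit, as `⌊log₂_⌋` is monotone and exact
-- at powers of two.
log₂-≤ : ∀ n .{{_ : NonZero n}} m → n ≤ 2 ^ m → ∀ k → seq (log₂ n) k ℚ.≤ ι m
log₂-≤ n m n≤2^m k = fraction-mono ⌊log₂ n ^ suc k ⌋ m k 0 (begin
  ⌊log₂ n ^ suc k ⌋ * 1           ≡⟨ *-identityʳ _ ⟩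
  ⌊log₂ n ^ suc k ⌋               ≤⟨ ⌊log₂⌋-mono-≤ (^-monoˡ-≤ (suc k) n≤2^m) ⟩
  ⌊log₂ (2 ^ m) ^ suc k ⌋         ≡⟨ cong ⌊log₂_⌋ (^-*-assoc 2 m (suc k)) ⟩
  ⌊log₂ 2 ^ (m * suc k) ⌋         ≡⟨ ⌊log₂[2^n]⌋≡n (m * suc k) ⟩
  m * suc k                       ∎)
  where open ≤-Reasoning

≤-log₂ : ∀ n .{{_ : NonZero n}} m → 2 ^ m ≤ n → ∀ k → ι m ℚ.≤ seq (log₂ n) k
≤-log₂ n m 2^m≤n k = fraction-mono m ⌊log₂ n ^ suc k ⌋ 0 k (begin
  m * suc k                       ≡⟨ sym (⌊log₂[2^n]⌋≡n (m * suc k)) ⟩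
  ⌊log₂ 2 ^ (m * suc k) ⌋         ≡⟨ cong ⌊log₂_⌋ (sym (^-*-assoc 2 m (suc k))) ⟩
  ⌊log₂ (2 ^ m) ^ suc k ⌋         ≤⟨ ⌊log₂⌋-mono-≤ (^-monoˡ-≤ (suc k) 2^m≤n) ⟩
  ⌊log₂ n ^ suc k ⌋               ≡⟨ sym (*-identityʳ _) ⟩
  ⌊log₂ n ^ suc k ⌋ * 1           ∎)
  where open ≤-Reasoning

half-log₂-≤ : ∀ n .{{_ : NonZero n}} h → n ≤ 2 ^ (h + h) → fromℚ ½ *ᴿ log₂ n ≤ᴿ fromℕ h
half-log₂-≤ n h n≤ ε ε>0 = 0 , λ k _ → begin
  ½ ℚ.* seq (log₂ n) k    ≤⟨ ℚ.*-monoˡ-≤-nonNeg ½ (log₂-≤ n (h + h) n≤ k) ⟩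
  ½ ℚ.* ι (h + h)         ≡⟨ cong (λ m → ½ ℚ.* ι (h + m)) (sym (+-identityʳ h)) ⟩
  ½ ℚ.* ι (2 * h)         ≡⟨ cong (½ ℚ.*_) (ι-* 2 h) ⟩
  ½ ℚ.* (ι 2 ℚ.* ι h)     ≡⟨ sym (ℚ.*-assoc ½ (ι 2) (ι h)) ⟩
  -- The product of `½` and `ι 2` evaluates to `1ℚ`.
  1ℚ ℚ.* ι h              ≡⟨ ℚ.*-identityˡ (ι h) ⟩
  ι h                     ≡⟨ sym (ℚ.+-identityʳ (ι h)) ⟩
  ι h ℚ.+ 0ℚ              ≤⟨ ℚ.+-monoʳ-≤ (ι h) (ℚ.<⇒≤ ε>0) ⟩
  ι h ℚ.+ ε               ∎
  where open ℚ.≤-Reasoning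

square-mono : ∀ {x y} → 0ℚ ℚ.≤ x → x ℚ.≤ y → x ℚ.* x ℚ.≤ y ℚ.* y
square-mono {x} {y} 0≤x x≤y = ℚ.≤-trans
  (ℚ.*-monoˡ-≤-nonNeg x {{ℚ.nonNegative 0≤x}} x≤y)
  (ℚ.*-monoʳ-≤-nonNeg y {{ℚ.nonNegative (ℚ.≤-trans 0≤x x≤y)}} x≤y)

<-4log₂² : ∀ n .{{_ : NonZero n}} l h → 2 ^ l ≤ n → h < 4 * (l * l) →
           fromℕ h <ᴿ fromℕ 4 *ᴿ (log₂ n *ᴿ log₂ n)
-- Both `h` and 4 l ^ 2 are integers, so strictness gives a gap of 1, valid from the first term on.
<-4log₂² n l h 2^l≤n h< = 1ℚ , ℚ.positive⁻¹ 1ℚ , 0 , λ k _ → begin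
  ι h ℚ.+ 1ℚ                 ≡⟨ sym (ι-+ h 1) ⟩
  ι (h + 1)                  ≤⟨ ι-mono {h + 1} (subst (_≤ 4 * (l * l)) (+-comm 1 h) h<) ⟩
  ι (4 * (l * l))            ≡⟨ trans (ι-* 4 (l * l)) (cong (ι 4 ℚ.*_) (ι-* l l)) ⟩
  ι 4 ℚ.* (ι l ℚ.* ι l)      ≤⟨ ℚ.*-monoˡ-≤-nonNeg (ι 4) (square-mono (ι-nonNeg l) (≤-log₂ n l 2^l≤n k)) ⟩
  ι 4 ℚ.* (seq (log₂ n) k ℚ.* seq (log₂ n) k) ∎
  where open ℚ.≤-Reasoning

-- Numerical estimates for k = 2 l + 6

2*tri : ∀ k → 2 * tri (suc k) ≡ suc k * k
2*tri zero    = refl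
2*tri (suc k) = trans (step k (tri (suc k))) (trans (cong (2 * suc k +_) (2*tri k)) (expand k))
  where
  step : ∀ k t → 2 * (suc k + t) ≡ 2 * suc k + 2 * t
  step = solve-∀
  expand : ∀ k → 2 * suc k + suc k * k ≡ suc (suc k) * suc k
  expand = solve-∀

-- The left side is at most 2 ^ (1 + (l + 1) k). As k - 1 exceeds 2 (l + 1) by 3, k (k - 1) exceeds
-- 2 (l + 1) k by 3 k, which is more than 2.
unionBound : ∀ n l → n < 2 ^ suc l → let k = 2 * l + 6 in 2 * n ^ k < 2 ^ tri k
unionBound n l n< = begin-strict
  2 * n ^ k                ≤⟨ *-monoʳ-≤ 2 (^-monoˡ-≤ k (<⇒≤ n<)) ⟩
  2 * (2 ^ suc l) ^ k      ≡⟨ cong (2 *_) (^-*-assoc 2 (suc l) k) ⟩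
  2 ^ suc (suc l * k)      <⟨ ^-monoʳ-< 2 ≤-refl exponents ⟩
  2 ^ tri k                ∎
  where
  open ≤-Reasoning
  k = 2 * l + 6
  exponents : suc (suc l * k) < tri k
  exponents = *-cancelˡ-< 2 _ _ (begin-strict
    -- The doubled exponents differ by 3 k - 2 = 6 l + 16; one unit of this is spent on strictness.
    2 * suc (suc l * k)                        <⟨ m≤m+n _ (6 * l + 15) ⟩
    suc (2 * suc (suc l * k)) + (6 * l + 15)   ≡⟨ expand l ⟩
    suc (2 * l + 5) * (2 * l + 5)              ≡⟨ sym (2*tri (2 * l + 5)) ⟩
    2 * tri (suc (2 * l + 5))                  ≡⟨ cong (λ j → 2 * tri j) (sym (+-suc (2 * l) 5)) ⟩
    2 * tri k                                  ∎)
    where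
    expand : ∀ l → suc (2 * suc (suc l * (2 * l + 6))) + (6 * l + 15) ≡ suc (2 * l + 5) * (2 * l + 5)
    expand = solve-∀

2k≤4l² : ∀ l → 3 ≤ l → 2 * (2 * l + 6) ≤ 4 * (l * l)
-- Substituting l = 3 + k leaves a difference with nonnegative coefficients. At l = 2 the inequality
-- fails, 20 against 16.
2k≤4l² l 3≤l with k , refl ← m≤n⇒∃[o]m+o≡n 3≤l = begin
  2 * (2 * (3 + k) + 6)                             ≤⟨ m≤m+n _ (12 + 20 * k + 4 * (k * k)) ⟩
  2 * (2 * (3 + k) + 6) + (12 + 20 * k + 4 * (k * k)) ≡⟨ expand k ⟩
  4 * ((3 + k) * (3 + k))                           ∎
  where
  open ≤-Reasoning
  expand : ∀ k → 2 * (2 * (3 + k) + 6) + (12 + 20 * k + 4 * (k * k)) ≡ 4 * ((3 + k) * (3 + k))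
  expand = solve-∀

mainTheorem7 : ∃[ N ] ((n : ℕ) .{{_ : NonZero n}} → N ≤ n →
    ∃[ h ] (Is-hᵣ 3 n (｛ (4 , 1) ｝ ∪ ｛ (4 , 3) ｝) h
    × fromℚ ½ *ᴿ log₂ n ≤ᴿ fromℕ h
    × fromℕ h <ᴿ fromℕ 4 *ᴿ (log₂ n *ᴿ log₂ n)))
mainTheorem7 = 8 , λ n 8≤n →
  -- The threshold 8 = 2 ^ 3 ensures that `l` is at least 3, as `2k≤4l²` requires.
  let l = ⌊log₂ n ⌋
      G , none = noMonoSubset n (2 * l + 6) (unionBound n l (⌊log₂⌋-upper n))
      h₀ , isH₀@((S , hom , ∣S∣≡h₀) , _) = ∃-Is-h (oddTriples G)
      -- The lower bound is applied to a minimising `H`; the upper bound compares `h` with the value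
      -- `h₀` of the two-graph of `G`.
      h , isMin@((H , free , isH) , minimal) = ∃-Is-hᵣ (oddTriples G) (oddTriples-free G) isH₀
      h≤h₀ = minimal h₀ (oddTriples G , oddTriples-free G , isH₀)
      h₀<2k = subst (_< 2 * (2 * l + 6)) ∣S∣≡h₀ (oddTriples-homogeneous G none S hom)
  in h , isMin , half-log₂-≤ n h (free⇒n≤4^h H free isH)
   , <-4log₂² n l h (⌊log₂⌋-lower n)
       (<-≤-trans (≤-<-trans h≤h₀ h₀<2k) (2k≤4l² l (⌊log₂⌋-mono-≤ 8≤n)))
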